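{- Let $F=\breve F(\alpha_1,\dots,\alpha_t)$ be a fence. A basis of $I_T(F)$ is \[ \mathcal B_I(F)=\bigcup_{i=1}^t\bigcup_{j=1}^{\beta_i}\{\alpha_i\hat\chi_{(i,j)}-j\hat\chi_p-(\alpha_i-j)\hat\chi_v : p\text{ the peak of }S_i,\ v\text{ the valley of }S_i\}, \] and consequently $\dim I_T(F)=\sum_{i=1}^t(\alpha_i-1)$.
   Context: Fences: let $\alpha=(\alpha_1,\dots,\alpha_t)$ be positive integers with $t\ge2$ and $\alpha_1,\alpha_t\ge2$. Put $a_0=0$, $a_i=\alpha_1+\dots+\alpha_i$, $n=a_t-1$. The fence $\breve F(\alpha)$ is the poset on $\{x_1,\dots,x_n\}$ whose cover relations are: for $1\le j\le n-1$ with $a_{i-1}\le j<a_i$, $x_j\lessdot x_{j+1}$ if $i$ is odd and $x_j\gtrdot x_{j+1}$ if $i$ is even. Segments: $S_1=\{x_j:1\le j\le a_1\}$, $S_i=\{x_j:a_{i-1}\le j\le a_i\}$ for $2\le i\le t-1$, $S_t=\{x_j:a_{t-1}\le j\le n\}$. Shared elements $x_{a_i}$ ($i\in[t-1]$) are peaks (cover two elements) for $i$ odd and valleys (covered by two elements) for $i$ even; the peak (valley) of $S_i$ is the shared element of $S_i$ that is a peak (valley), if any; if it does not exist, the corresponding $\hat\chi$ is identically zero. $\breve S_i$ is the set of non-shared elements of $S_i$, $\beta_i=\alpha_i-1$, $s_{(i,j)}$ is the $j$-th smallest element of $\breve S_i$, $\hat\chi_{(i,j)}=\hat\chi_{s_{(i,j)}}$.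 For $q\in F$ and order ideal $I$: $\hat\chi_q(I)=1$ if $q\in I$, else $0$; $T_q(I)=1$ if $q\in\min(F\setminus I)$, $-1$ if $q\in\max(I)$, $0$ otherwise. $f\equiv\text{const}$ means $f=c+\sum_qc_qT_q$ for real constants. $I_T(F)=\{f\in\operatorname{Span}_{\mathbb R}\{\hat\chi_q:q\in F\}: f\equiv\text{const}\}$. -}

module Defs where

open import Algebra.Bundles using (CommutativeRing)
import Algebra.Properties.CommutativeMonoid.Sum as CommutativeMonoidSum
import Algebra.Definitions.RawMonoid as RawMonoidDefinitions
open import Data.Bool.Base using (if_then_else_)
open import Data.Fin.Base using (Fin; toℕ; fromℕ<)
open import Data.Fin.Properties using (all?; any?; toℕ<n; toℕ-fromℕ<; toℕ-injective)
  renaming (_≟_ to _≟ᶠ_)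
open import Data.Fin.Subset using (Subset; _∈_; _∉_)
open import Data.Fin.Subset.Properties using (_∈?_)
open import Data.List.Base using (List; []; _∷_; concat; length; lookup; tabulate; take)
open import Data.Maybe.Base using (Maybe; just; nothing)
import Data.Maybe.Base as Maybe
open import Data.Nat.Base using (ℕ; zero; suc; _≤_; _<_; _∸_; z≤n; s≤s; s≤s⁻¹; parity)
import Data.Nat.Base as ℕ
open import Data.Nat.ListAction using (sum)
import Data.Nat.Properties as ℕₚ
open import Data.Parity.Base using (Parity; 0ℙ; 1ℙ)
import Data.Parity.Properties as Parityₚ
open import Data.Product.Base using (∃; _×_; _,_; proj₁; proj₂)
open import Data.Rational.Base as ℚ using (ℚ; 0ℚ; 1ℚ; ½; ∣_∣)
import Data.Rational.Properties as ℚₚ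
open import Data.Rational.Solver using (module +-*-Solver)
open import Data.Sum.Base using (_⊎_; inj₁; inj₂)
open import Data.Empty using (⊥; ⊥-elim)
open import Function.Base using (case_of_)
open import Function.Bundles using (_⇔_; mk⇔)
open import Level using (0ℓ)
open import Relation.Binary.Construct.Closure.ReflexiveTransitive using (Star; ε; _◅_; _◅◅_)
open import Relation.Binary.Core using (Rel)
open import Relation.Binary.Definitions using (Decidable)
open import Relation.Binary.Structures using (IsDecPartialOrder)
open import Relation.Binary.PropositionalEquality
  using (_≡_; _≢_; refl; sym; trans; cong; subst; subst₂; isEquivalence)
open import Relation.Nullary using (¬_; Dec; yes; no; does; contradiction)
open import Relation.Nullary.Decidable using (_×-dec_; _⊎-dec_; _→-dec_; ¬?; map′; dec⇒maybe)
import Relation.Unary as U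

------------------------------------------------------------------------
-- Real numbers, as Cauchy sequences of rationals

module Reals where

  -- For Cauchy sequences, Close x y says exactly that x n - y n tends to
  -- zero; Close x x is the Cauchy condition.
  Close : Rel (ℕ → ℚ) 0ℓ
  Close x y = ∀ e → 0ℚ ℚ.< e →
    ∃ λ N → ∀ m n → N ≤ m → N ≤ n → ∣ x m ℚ.- y n ∣ ℚ.< e

  record ℝ : Set where
    constructor mkℝ
    field
      seq    : ℕ → ℚ
      cauchy : Close seq seq

  open ℝ public

  infix 4 _≈_
  _≈_ : Rel ℝ 0ℓ
  x ≈ y = Close (seq x) (seq y)

  private
    module Identities where
      open +-*-Solver

      swap : ∀ p q → p ℚ.- q ≡ ℚ.- (q ℚ.- p)
      swap = solve 2 (λ a b → a :- b := :- (b :- a)) refl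

      split : ∀ p q r → p ℚ.- r ≡ (p ℚ.- q) ℚ.+ (q ℚ.- r)
      split = solve 3 (λ a b c → a :- c := (a :- b) :+ (b :- c)) refl

      cancel : ∀ p q → (p ℚ.- q) ℚ.+ q ≡ p
      cancel = solve 2 (λ a b → (a :- b) :+ b := a) refl

      neg-diff : ∀ p q → q ℚ.- p ≡ (ℚ.- p) ℚ.- (ℚ.- q)
      neg-diff = solve 2 (λ a b → b :- a := (:- a) :- (:- b)) refl

      +-diff : ∀ p q r s →
        (p ℚ.+ q) ℚ.- (r ℚ.+ s) ≡ (p ℚ.- r) ℚ.+ (q ℚ.- s)
      +-diff = solve 4 (λ a b c d → (a :+ b) :- (c :+ d) := (a :- c) :+ (b :- d)) refl

      *-diff : ∀ p q r s →
        p ℚ.* q ℚ.- r ℚ.* s ≡ p ℚ.* (q ℚ.- s) ℚ.+ s ℚ.* (p ℚ.- r)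
      *-diff = solve 4 (λ a b c d → a :* b :- c :* d := a :* (b :- d) :+ d :* (a :- c)) refl

    open Identities

    half : ∀ e → 0ℚ ℚ.< e → 0ℚ ℚ.< ½ ℚ.* e
    half e 0<e = subst (ℚ._< ½ ℚ.* e) (ℚₚ.*-zeroʳ ½) (ℚₚ.*-monoʳ-<-pos ½ 0<e)

    halves : ∀ e → ½ ℚ.* e ℚ.+ ½ ℚ.* e ≡ e
    halves e = trans (sym (ℚₚ.*-distribʳ-+ e ½ ½)) (ℚₚ.*-identityˡ e)

    max₁ : ∀ {a b c} → a ℕ.⊔ b ≤ c → a ≤ c
    max₁ {a} {b} = ℕₚ.≤-trans (ℕₚ.m≤m⊔n a b)

    max₂ : ∀ {a b c} → a ℕ.⊔ b ≤ c → b ≤ c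
    max₂ {a} {b} = ℕₚ.≤-trans (ℕₚ.m≤n⊔m a b)

    triangle : ∀ {e} p q r → p ≡ q ℚ.+ r →
      ∣ q ∣ ℚ.< ½ ℚ.* e → ∣ r ∣ ℚ.< ½ ℚ.* e → ∣ p ∣ ℚ.< e
    triangle {e} p q r refl hq hr =
      ℚₚ.≤-<-trans (ℚₚ.∣p+q∣≤∣p∣+∣q∣ q r)
        (subst (_ ℚ.<_) (halves e) (ℚₚ.+-mono-< hq hr))

    ∣-∣-sym : ∀ p q → ∣ p ℚ.- q ∣ ≡ ∣ q ℚ.- p ∣
    ∣-∣-sym p q = trans (cong ∣_∣ (swap p q)) (ℚₚ.∣-p∣≡∣p∣ (q ℚ.- p))

    close-sym : ∀ {x y} → Close x y → Close y x
    close-sym {x} {y} h e 0<e with h e 0<e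
    ... | N , hN = N , λ m n N≤m N≤n →
      subst (ℚ._< e) (∣-∣-sym (x n) (y m)) (hN n m N≤n N≤m)

    close-trans : ∀ {x y z} → Close x y → Close y z → Close x z
    close-trans {x} {y} {z} h k e 0<e
      with h (½ ℚ.* e) (half e 0<e) | k (½ ℚ.* e) (half e 0<e)
    ... | M , hM | N , hN = M ℕ.⊔ N , λ m n m≥ n≥ →
      triangle (x m ℚ.- z n) (x m ℚ.- y m) (y m ℚ.- z n)
        (split (x m) (y m) (z n))
        (hM m m (max₁ {M} {N} m≥) (max₁ {M} {N} m≥))
        (hN m n (max₂ {M} {N} m≥) (max₂ {M} {N} n≥))

    close-+ : ∀ {x x′ y y′} → Close x x′ → Close y y′ →
      Close (λ n → x n ℚ.+ y n) (λ n → x′ n ℚ.+ y′ n)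
    close-+ {x} {x′} {y} {y′} h k e 0<e
      with h (½ ℚ.* e) (half e 0<e) | k (½ ℚ.* e) (half e 0<e)
    ... | M , hM | N , hN = M ℕ.⊔ N , λ m n m≥ n≥ →
      triangle ((x m ℚ.+ y m) ℚ.- (x′ n ℚ.+ y′ n)) (x m ℚ.- x′ n) (y m ℚ.- y′ n)
        (+-diff (x m) (y m) (x′ n) (y′ n))
        (hM m n (max₁ {M} {N} m≥) (max₁ {M} {N} n≥))
        (hN m n (max₂ {M} {N} m≥) (max₂ {M} {N} n≥))

    close-neg : ∀ {x x′} → Close x x′ → Close (λ n → ℚ.- x n) (λ n → ℚ.- x′ n)
    close-neg {x} {x′} h e 0<e with h e 0<e
    ... | N , hN = N , λ m n N≤m N≤n →
      subst (ℚ._< e)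
        (trans (∣-∣-sym (x m) (x′ n))
          (cong ∣_∣ (neg-diff (x m) (x′ n))))
        (hN m n N≤m N≤n)

    0<1 : 0ℚ ℚ.< 1ℚ
    0<1 = ℚₚ.positive⁻¹ 1ℚ

    bound : ∀ {x x′} → Close x x′ →
      ∃ λ K → ℚ.Positive K × ∃ λ N → ∀ m → N ≤ m → ∣ x m ∣ ℚ.< K
    bound {x} {x′} h with h 1ℚ 0<1
    ... | N , hN =
      1ℚ ℚ.+ ∣ x′ N ∣ ,
      ℚₚ.pos+nonNeg⇒pos 1ℚ ∣ x′ N ∣ {{ℚₚ.∣-∣-nonNeg (x′ N)}} ,
      N , λ m N≤m →
        ℚₚ.≤-<-trans
          (subst (λ z → ∣ z ∣ ℚ.≤ ∣ x m ℚ.- x′ N ∣ ℚ.+ ∣ x′ N ∣)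
            (cancel (x m) (x′ N))
            (ℚₚ.∣p+q∣≤∣p∣+∣q∣ (x m ℚ.- x′ N) (x′ N)))
          (ℚₚ.+-monoˡ-< ∣ x′ N ∣ (hN m N N≤m ℕₚ.≤-refl))

    inv : ∀ K → ℚ.Positive K → ℚ
    inv K K>0 = (ℚ.1/ K) {{ℚₚ.pos⇒nonZero K {{K>0}}}}

    scaled : ℚ → ∀ K → ℚ.Positive K → ℚ
    scaled e K K>0 = inv K K>0 ℚ.* e

    scaled-pos : ∀ e K (K>0 : ℚ.Positive K) → 0ℚ ℚ.< e → 0ℚ ℚ.< scaled e K K>0
    scaled-pos e K K>0 0<e =
      subst (ℚ._< scaled e K K>0) (ℚₚ.*-zeroʳ (inv K K>0))
        (ℚₚ.*-monoʳ-<-pos (inv K K>0) {{ℚₚ.1/pos⇒pos K {{K>0}}}} 0<e)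

    scaled-cancel : ∀ e K (K>0 : ℚ.Positive K) → K ℚ.* scaled e K K>0 ≡ e
    scaled-cancel e K K>0 =
      trans (sym (ℚₚ.*-assoc K (inv K K>0) e))
        (trans (cong (ℚ._* e) (ℚₚ.*-inverseʳ K {{ℚₚ.pos⇒nonZero K {{K>0}}}}))
          (ℚₚ.*-identityˡ e))

    small-* : ∀ {e} K (K>0 : ℚ.Positive K) p q →
      ∣ p ∣ ℚ.< K → ∣ q ∣ ℚ.< scaled e K K>0 → ∣ p ℚ.* q ∣ ℚ.< e
    small-* {e} K K>0 p q hp hq =
      subst (ℚ._< e) (sym (ℚₚ.∣p*q∣≡∣p∣*∣q∣ p q))
        (ℚₚ.≤-<-trans
          (ℚₚ.*-monoʳ-≤-nonNeg ∣ q ∣ {{ℚₚ.∣-∣-nonNeg q}} (ℚₚ.<⇒≤ hp))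
          (subst (K ℚ.* ∣ q ∣ ℚ.<_) (scaled-cancel e K K>0)
            (ℚₚ.*-monoʳ-<-pos K {{K>0}} hq)))

    close-* : ∀ {x x′ y y′} → Close x x′ → Close y y′ →
      Close (λ n → x n ℚ.* y n) (λ n → x′ n ℚ.* y′ n)
    close-* {x} {x′} {y} {y′} h k e 0<e =
      let
        K , K>0 , A , hA = bound {x} {x′} h
        L , L>0 , B , hB = bound {y′} {y} (close-sym {y} {y′} k)
        e/2 = ½ ℚ.* e
        M , hM = h (scaled e/2 L L>0) (scaled-pos e/2 L L>0 (half e 0<e))
        N , hN = k (scaled e/2 K K>0) (scaled-pos e/2 K K>0 (half e 0<e))
      in (A ℕ.⊔ B) ℕ.⊔ (M ℕ.⊔ N) , λ m n m≥ n≥ →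
      triangle (x m ℚ.* y m ℚ.- x′ n ℚ.* y′ n)
        (x m ℚ.* (y m ℚ.- y′ n)) (y′ n ℚ.* (x m ℚ.- x′ n))
        (*-diff (x m) (y m) (x′ n) (y′ n))
        (small-* K K>0 (x m) (y m ℚ.- y′ n)
          (hA m (max₁ {A} {B} (max₁ {A ℕ.⊔ B} {M ℕ.⊔ N} m≥)))
          (hN m n (max₂ {M} {N} (max₂ {A ℕ.⊔ B} {M ℕ.⊔ N} m≥))
                  (max₂ {M} {N} (max₂ {A ℕ.⊔ B} {M ℕ.⊔ N} n≥))))
        (small-* L L>0 (y′ n) (x m ℚ.- x′ n)
          (hB n (max₂ {A} {B} (max₁ {A ℕ.⊔ B} {M ℕ.⊔ N} n≥)))
          (hM m n (max₁ {M} {N} (max₂ {A ℕ.⊔ B} {M ℕ.⊔ N} m≥))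
                  (max₁ {M} {N} (max₂ {A ℕ.⊔ B} {M ℕ.⊔ N} n≥))))

    close-const : ∀ q → Close (λ _ → q) (λ _ → q)
    close-const q e 0<e =
      0 , λ _ _ _ _ → subst (λ z → ∣ z ∣ ℚ.< e) (sym (ℚₚ.+-inverseʳ q)) 0<e

  fromℚ : ℚ → ℝ
  fromℚ q = mkℝ (λ _ → q) (close-const q)

  infixl 6 _+ᴿ_
  infixl 7 _*ᴿ_

  _+ᴿ_ _*ᴿ_ : ℝ → ℝ → ℝ
  x +ᴿ y = mkℝ (λ n → seq x n ℚ.+ seq y n)
    (close-+ {seq x} {seq x} {seq y} {seq y} (cauchy x) (cauchy y))
  x *ᴿ y = mkℝ (λ n → seq x n ℚ.* seq y n)
    (close-* {seq x} {seq x} {seq y} {seq y} (cauchy x) (cauchy y))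

  -ᴿ_ : ℝ → ℝ
  -ᴿ x = mkℝ (λ n → ℚ.- seq x n) (close-neg {seq x} {seq x} (cauchy x))

  pointwise : ∀ x y → (∀ n → seq x n ≡ seq y n) → x ≈ y
  pointwise x y h e 0<e with cauchy x e 0<e
  ... | N , hN = N , λ m n N≤m N≤n →
    subst (λ z → ∣ seq x m ℚ.- z ∣ ℚ.< e) (h n) (hN m n N≤m N≤n)

  ℝ-commutativeRing : CommutativeRing 0ℓ 0ℓ
  ℝ-commutativeRing = record
    { Carrier = ℝ
    ; _≈_ = _≈_
    ; _+_ = _+ᴿ_
    ; _*_ = _*ᴿ_
    ; -_ = -ᴿ_
    ; 0# = fromℚ 0ℚ
    ; 1# = fromℚ 1ℚ
    ; isCommutativeRing = record
      { isRing = record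
        { +-isAbelianGroup = record
          { isGroup = record
            { isMonoid = record
              { isSemigroup = record
                { isMagma = record
                  { isEquivalence = ≈-isEquivalence
                  ; ∙-cong = λ {x} {x′} {y} {y′} →
                      close-+ {seq x} {seq x′} {seq y} {seq y′}
                  }
                ; assoc = λ x y z → pointwise ((x +ᴿ y) +ᴿ z) (x +ᴿ (y +ᴿ z))
                    λ n → ℚₚ.+-assoc (seq x n) (seq y n) (seq z n)
                }
              ; identity =
                  (λ x → pointwise (fromℚ 0ℚ +ᴿ x) x λ n → ℚₚ.+-identityˡ (seq x n))
                , (λ x → pointwise (x +ᴿ fromℚ 0ℚ) x λ n → ℚₚ.+-identityʳ (seq x n))
              }
            ; inverse =
                (λ x → pointwise ((-ᴿ x) +ᴿ x) (fromℚ 0ℚ) λ n → ℚₚ.+-inverseˡ (seq x n))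
              , (λ x → pointwise (x +ᴿ (-ᴿ x)) (fromℚ 0ℚ) λ n → ℚₚ.+-inverseʳ (seq x n))
            ; ⁻¹-cong = λ {x} {y} → close-neg {seq x} {seq y}
            }
          ; comm = λ x y → pointwise (x +ᴿ y) (y +ᴿ x)
              λ n → ℚₚ.+-comm (seq x n) (seq y n)
          }
        ; *-cong = λ {x} {x′} {y} {y′} → close-* {seq x} {seq x′} {seq y} {seq y′}
        ; *-assoc = λ x y z → pointwise ((x *ᴿ y) *ᴿ z) (x *ᴿ (y *ᴿ z))
            λ n → ℚₚ.*-assoc (seq x n) (seq y n) (seq z n)
        ; *-identity =
            (λ x → pointwise (fromℚ 1ℚ *ᴿ x) x λ n → ℚₚ.*-identityˡ (seq x n))
          , (λ x → pointwise (x *ᴿ fromℚ 1ℚ) x λ n → ℚₚ.*-identityʳ (seq x n))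
        ; distrib =
            (λ x y z → pointwise (x *ᴿ (y +ᴿ z)) ((x *ᴿ y) +ᴿ (x *ᴿ z))
              λ n → ℚₚ.*-distribˡ-+ (seq x n) (seq y n) (seq z n))
          , (λ x y z → pointwise ((y +ᴿ z) *ᴿ x) ((y *ᴿ x) +ᴿ (z *ᴿ x))
              λ n → ℚₚ.*-distribʳ-+ (seq x n) (seq y n) (seq z n))
        }
      ; *-comm = λ x y → pointwise (x *ᴿ y) (y *ᴿ x)
          λ n → ℚₚ.*-comm (seq x n) (seq y n)
      }
    }
    where
    ≈-isEquivalence = record
      { refl = λ {x} → cauchy x
      ; sym = λ {x} {y} → close-sym {seq x} {seq y}
      ; trans = λ {x} {y} {z} → close-trans {seq x} {seq y} {seq z}
      }

open Reals public using (ℝ; ℝ-commutativeRing)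

------------------------------------------------------------------------
-- Vector spaces of functions, with pointwise operations. Scalars are kept
-- abstract here and below only so that the construction of ℝ does not get
-- unfolded; the intended scalars are ℝ-commutativeRing.

module FunctionSpace (R : CommutativeRing 0ℓ 0ℓ) {X : Set} where

  open CommutativeRing R
  open CommutativeMonoidSum +-commutativeMonoid using () renaming (sum to ∑)

  infix 4 _≋_ _∈Span_

  _≋_ : Rel (X → Carrier) 0ℓ
  f ≋ g = ∀ x → f x ≈ g x

  lincomb : ∀ {m} → (Fin m → Carrier) → (Fin m → X → Carrier) → X → Carrier
  lincomb c b x = ∑ λ k → c k * b k x

  _∈Span_ : ∀ {m} → (X → Carrier) → (Fin m → X → Carrier) → Set
  f ∈Span b = ∃ λ c → f ≋ lincomb c b

  LinearlyIndependent : ∀ {m} → (Fin m → X → Carrier) → Set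
  LinearlyIndependent b = ∀ c → lincomb c b ≋ (λ _ → 0#) → ∀ k → c k ≈ 0#

  -- V is meant to be a linear subspace.
  record IsBasis (V : (X → Carrier) → Set) {m : ℕ} (b : Fin m → X → Carrier) : Set where
    field
      members     : ∀ k → V (b k)
      independent : LinearlyIndependent b
      spanning    : ∀ f → V f → f ∈Span b

  HasDimension : ((X → Carrier) → Set) → ℕ → Set
  HasDimension V d = ∃ λ (b : Fin d → X → Carrier) → IsBasis V b

------------------------------------------------------------------------
-- Order ideals of a finite poset, with their indicator and toggle functions

module FinitePoset {n : ℕ} {_≼_ : Rel (Fin n) 0ℓ}
  (isDecPartialOrder : IsDecPartialOrder _≡_ _≼_) where

  open IsDecPartialOrder isDecPartialOrder using () renaming (_≤?_ to _≼?_)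

  Covers : Rel (Fin n) 0ℓ
  Covers x y = x ≼ y × x ≢ y × (∀ z → x ≼ z → z ≼ y → z ≡ x ⊎ z ≡ y)

  record OrderIdeal : Set where
    constructor mkIdeal
    field
      set     : Subset n
      isLower : ∀ {p q} → q ∈ set → p ≼ q → p ∈ set

  open OrderIdeal public

  IsMaximalIn IsMinimalOutside : Fin n → Subset n → Set
  IsMaximalIn      q I = q ∈ I × (∀ p → p ∈ I → q ≼ p → p ≡ q)
  IsMinimalOutside q I = q ∉ I × (∀ p → p ∉ I → p ≼ q → p ≡ q)

  isMaximalIn? : Decidable IsMaximalIn
  isMaximalIn? q I =
    (q ∈? I) ×-dec all? λ p → (p ∈? I) →-dec ((q ≼? p) →-dec (p ≟ᶠ q))

  isMinimalOutside? : Decidable IsMinimalOutside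
  isMinimalOutside? q I =
    ¬? (q ∈? I) ×-dec all? λ p → ¬? (p ∈? I) →-dec ((p ≼? q) →-dec (p ≟ᶠ q))

module ToggleFunctions (R : CommutativeRing 0ℓ 0ℓ) {n : ℕ} {_≼_ : Rel (Fin n) 0ℓ}
  (isDecPartialOrder : IsDecPartialOrder _≡_ _≼_) where

  open CommutativeRing R
  open FinitePoset isDecPartialOrder
  open FunctionSpace R {OrderIdeal}

  χ̂ : Fin n → OrderIdeal → Carrier
  χ̂ q I = if does (q ∈? set I) then 1# else 0#

  T : Fin n → OrderIdeal → Carrier
  T q I = if does (isMinimalOutside? q (set I)) then 1#
          else if does (isMaximalIn? q (set I)) then - 1#
          else 0#

  _≡const : (OrderIdeal → Carrier) → Set
  f ≡const = ∃ λ c → ∃ λ (cs : Fin n → Carrier) → f ≋ λ I → c + lincomb cs T I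

  I_T : (OrderIdeal → Carrier) → Set
  I_T f = f ∈Span χ̂ × f ≡const

------------------------------------------------------------------------
-- Fences

Odd Even : ℕ → Set
Odd  k = parity k ≡ 1ℙ
Even k = parity k ≡ 0ℙ

record IsFenceShape (α : List ℕ) : Set where
  field
    t≥2      : 2 ≤ length α
    positive : ∀ i → 1 ≤ lookup α i
    first≥2  : ∀ i → toℕ i ≡ 0 → 2 ≤ lookup α i
    last≥2   : ∀ i → suc (toℕ i) ≡ length α → 2 ≤ lookup α i

-- Segments are indexed from zero: i : Fin t stands for the segment usually
-- numbered suc (toℕ i), which lies between positions a (toℕ i) and
-- a (suc (toℕ i)).
module Fence (α : List ℕ) where

  t : ℕ
  t = length α

  a : ℕ → ℕ
  a k = sum (take k α)

  n : ℕ
  n = sum α ∸ 1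

  -- The element x_j is the one with pos x ≡ j.
  pos : Fin n → ℕ
  pos x = suc (toℕ x)

  InSegmentOf : (ℕ → Set) → ℕ → Set
  InSegmentOf P j = ∃ λ (i : Fin t) →
    a (toℕ i) ≤ j × j < a (suc (toℕ i)) × P (suc (toℕ i))

  Ascent Descent : ℕ → Set
  Ascent  = InSegmentOf Odd
  Descent = InSegmentOf Even

  infix 4 _⋖_ _≼_

  -- ⋖⇔covers below confirms that this is the cover relation of _≼_.
  data _⋖_ (x y : Fin n) : Set where
    up   : pos y ≡ suc (pos x) → Ascent  (pos x) → x ⋖ y
    down : pos x ≡ suc (pos y) → Descent (pos y) → x ⋖ y

  _≼_ : Rel (Fin n) 0ℓ
  _≼_ = Star _⋖_

  a-suc : ∀ (i : Fin t) → a (suc (toℕ i)) ≡ a (toℕ i) ℕ.+ lookup α i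
  a-suc = go α
    where
    go : ∀ (β : List ℕ) (i : Fin (length β)) →
      sum (take (suc (toℕ i)) β) ≡ sum (take (toℕ i) β) ℕ.+ lookup β i
    go (b ∷ β) Fin.zero    = ℕₚ.+-comm b 0
    go (b ∷ β) (Fin.suc i) =
      trans (cong (b ℕ.+_) (go β i)) (sym (ℕₚ.+-assoc b _ (lookup β i)))

  a-mono : ∀ {k l} → k ≤ l → a k ≤ a l
  a-mono = go α
    where
    go : ∀ (β : List ℕ) {k l} → k ≤ l → sum (take k β) ≤ sum (take l β)
    go β       z≤n       = z≤n
    go []      (s≤s k≤l) = z≤n
    go (b ∷ β) (s≤s k≤l) = ℕₚ.+-monoʳ-≤ b (go β k≤l)

  a-t : a t ≡ sum α
  a-t = go α
    where
    go : ∀ (β : List ℕ) → sum (take (length β) β) ≡ sum β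
    go []      = refl
    go (b ∷ β) = cong (b ℕ.+_) (go β)

  a≤sum : ∀ (i : Fin t) → a (suc (toℕ i)) ≤ sum α
  a≤sum i = subst (a (suc (toℕ i)) ≤_) a-t (a-mono (toℕ<n i))

  inSegmentOf? : ∀ {P : ℕ → Set} → (∀ k → Dec (P k)) → ∀ j → Dec (InSegmentOf P j)
  inSegmentOf? P? j = any? λ i →
    (a (toℕ i) ℕₚ.≤? j) ×-dec ((j ℕₚ.<? a (suc (toℕ i))) ×-dec P? (suc (toℕ i)))

  odd? : ∀ k → Dec (Odd k)
  odd? k = parity k Parityₚ.≟ 1ℙ

  even? : ∀ k → Dec (Even k)
  even? k = parity k Parityₚ.≟ 0ℙ

  same-segment : ∀ {j} (i k : Fin t) →
    a (toℕ i) ≤ j → j < a (suc (toℕ i)) → a (toℕ k) ≤ j → j < a (suc (toℕ k)) →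
    toℕ i ≡ toℕ k
  same-segment i k i≤ <i k≤ <k = ℕₚ.≤-antisym
    (ℕₚ.≮⇒≥ λ k<i → ℕₚ.<⇒≱ <k (ℕₚ.≤-trans (a-mono k<i) i≤))
    (ℕₚ.≮⇒≥ λ i<k → ℕₚ.<⇒≱ <i (ℕₚ.≤-trans (a-mono i<k) k≤))

  ¬both : ∀ {j} → Ascent j → Descent j → ⊥
  ¬both (i , i≤ , <i , o) (k , k≤ , <k , e)
    with trans (sym o) (trans (cong (λ z → parity (suc z)) (same-segment i k i≤ <i k≤ <k)) e)
  ... | ()

  -- Two elements are comparable exactly when all the steps between them
  -- go the same way.
  Run : (ℕ → Set) → ℕ → ℕ → Set
  Run P k l = k ≤ l × (∀ {j} → j < l → k ≤ j → P j)

  run? : ∀ {P : ℕ → Set} → (∀ j → Dec (P j)) → ∀ k l → Dec (Run P k l)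
  run? P? k l = (k ℕₚ.≤? l) ×-dec ℕₚ.allUpTo? (λ j → (k ℕₚ.≤? j) →-dec P? j) l

  Comparable : Rel (Fin n) 0ℓ
  Comparable x y = Run Ascent (pos x) (pos y) ⊎ Run Descent (pos y) (pos x)

  comparable? : Decidable Comparable
  comparable? x y =
    run? (inSegmentOf? odd?) (pos x) (pos y) ⊎-dec
    run? (inSegmentOf? even?) (pos y) (pos x)

  empty-run : ∀ {P k l} → k ≡ l → Run P k l
  empty-run refl = ℕₚ.≤-refl , λ j<k k≤j → contradiction k≤j (ℕₚ.<⇒≱ j<k)

  extendˡ : ∀ {P k l} → P k → Run P (suc k) l → Run P k l
  extendˡ {P} {k} pk (k<l , run) = ℕₚ.<⇒≤ k<l , λ {j} j<l k≤j →
    case ℕₚ.m≤n⇒m<n∨m≡n k≤j of λ where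
      (inj₁ k<j)  → run j<l k<j
      (inj₂ refl) → pk

  extendʳ : ∀ {P k l} → P l → Run P k l → Run P k (suc l)
  extendʳ {P} {k} {l} pl (k≤l , run) = ℕₚ.m≤n⇒m≤1+n k≤l , λ {j} j<1+l k≤j →
    case ℕₚ.m≤n⇒m<n∨m≡n (s≤s⁻¹ j<1+l) of λ where
      (inj₁ j<l)  → run j<l k≤j
      (inj₂ refl) → pl

  star⇒run : ∀ {x y} → x ≼ y → Comparable x y
  star⇒run ε = inj₁ (empty-run refl)
  star⇒run {x} {y} (_◅_ {j = z} (up z≡1+x asc) zy) with star⇒run zy
  ... | inj₁ r = inj₁ (extendˡ asc (subst (λ k → Run Ascent k (pos y)) z≡1+x r))
  ... | inj₂ (y≤z , run) with ℕₚ.m≤n⇒m<n∨m≡n y≤z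
  ...   | inj₂ y≡z = inj₁ (extendˡ asc (empty-run (trans (sym z≡1+x) (sym y≡z))))
  ...   | inj₁ y<z = ⊥-elim (¬both asc
            (run (ℕₚ.≤-reflexive (sym z≡1+x)) (s≤s⁻¹ (subst (pos y <_) z≡1+x y<z))))
  star⇒run {x} {y} (_◅_ {j = z} (down x≡1+z des) zy) with star⇒run zy
  ... | inj₂ r = inj₂ (subst (Run Descent (pos y)) (sym x≡1+z) (extendʳ des r))
  ... | inj₁ (z≤y , run) with ℕₚ.m≤n⇒m<n∨m≡n z≤y
  ...   | inj₂ z≡y = inj₂ (subst (Run Descent (pos y)) (sym x≡1+z)
            (extendʳ des (empty-run (sym z≡y))))
  ...   | inj₁ z<y = ⊥-elim (¬both (run z<y ℕₚ.≤-refl) des)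

  pos-injective : ∀ {x y} → pos x ≡ pos y → x ≡ y
  pos-injective eq = toℕ-injective (ℕₚ.suc-injective eq)

  next : ∀ (x y : Fin n) → pos x < pos y → ∃ λ z → pos z ≡ suc (pos x)
  next x y x<y = fromℕ< 1+x<n , cong suc (toℕ-fromℕ< 1+x<n)
    where
    1+x<n : suc (toℕ x) < n
    1+x<n = ℕₚ.≤-<-trans (s≤s⁻¹ x<y) (toℕ<n y)

  ascend : ∀ d {x y} → pos y ≡ d ℕ.+ pos x → Run Ascent (pos x) (pos y) → x ≼ y
  ascend zero    eq r = subst (_ ≼_) (pos-injective (sym eq)) ε
  ascend (suc d) {x} {y} eq (x≤y , run) =
    let x<y : pos x < pos y
        x<y = subst (pos x <_) (sym eq) (s≤s (ℕₚ.m≤n+m (pos x) d))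
        z , z≡ = next x y x<y
    in up z≡ (run x<y ℕₚ.≤-refl) ◅
       ascend d (trans eq (trans (sym (ℕₚ.+-suc d (pos x))) (cong (d ℕ.+_) (sym z≡))))
         (subst (_≤ pos y) (sym z≡) x<y ,
          λ {j} j<y z≤j → run j<y (ℕₚ.<⇒≤ (subst (_≤ j) z≡ z≤j)))

  descend : ∀ d {x y} → pos y ≡ d ℕ.+ pos x → Run Descent (pos x) (pos y) → y ≼ x
  descend zero    eq r = subst (_≼ _) (pos-injective (sym eq)) ε
  descend (suc d) {x} {y} eq (x≤y , run) =
    let x<y : pos x < pos y
        x<y = subst (pos x <_) (sym eq) (s≤s (ℕₚ.m≤n+m (pos x) d))
        z , z≡ = next x y x<y
    in descend d (trans eq (trans (sym (ℕₚ.+-suc d (pos x))) (cong (d ℕ.+_) (sym z≡))))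
         (subst (_≤ pos y) (sym z≡) x<y ,
          λ {j} j<y z≤j → run j<y (ℕₚ.<⇒≤ (subst (_≤ j) z≡ z≤j)))
       ◅◅ down z≡ (run x<y ℕₚ.≤-refl) ◅ ε

  run⇒star : ∀ {x y} → Comparable x y → x ≼ y
  run⇒star {x} {y} (inj₁ r) = ascend  (pos y ∸ pos x) (sym (ℕₚ.m∸n+n≡m (proj₁ r))) r
  run⇒star {x} {y} (inj₂ r) = descend (pos x ∸ pos y) (sym (ℕₚ.m∸n+n≡m (proj₁ r))) r

  infix 4 _≼?_
  _≼?_ : Decidable _≼_
  x ≼? y = map′ run⇒star star⇒run (comparable? x y)

  opposite-runs : ∀ {k l m} → Run Ascent k m → Run Descent l m → k < m → l < m → ⊥
  opposite-runs {m = suc m} (_ , r) (_ , s) k<m l<m =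
    ¬both (r ℕₚ.≤-refl (s≤s⁻¹ k<m)) (s ℕₚ.≤-refl (s≤s⁻¹ l<m))

  run-antisym : ∀ {k l} → Run Ascent k l → Run Descent k l → k ≡ l
  run-antisym r s with ℕₚ.m≤n⇒m<n∨m≡n (proj₁ r)
  ... | inj₂ eq  = eq
  ... | inj₁ k<l = ⊥-elim (opposite-runs r s k<l k<l)

  ≼-antisym : ∀ {x y} → x ≼ y → y ≼ x → x ≡ y
  ≼-antisym xy yx with star⇒run xy | star⇒run yx
  ... | inj₁ r | inj₁ s = pos-injective (ℕₚ.≤-antisym (proj₁ r) (proj₁ s))
  ... | inj₁ r | inj₂ s = pos-injective (run-antisym r s)
  ... | inj₂ r | inj₁ s = pos-injective (sym (run-antisym s r))
  ... | inj₂ r | inj₂ s = pos-injective (ℕₚ.≤-antisym (proj₁ s) (proj₁ r))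

  isDecPartialOrder : IsDecPartialOrder _≡_ _≼_
  isDecPartialOrder = record
    { isPartialOrder = record
      { isPreorder = record
        { isEquivalence = isEquivalence
        ; reflexive = λ { refl → ε }
        ; trans = _◅◅_
        }
      ; antisym = ≼-antisym
      }
    ; _≟_ = _≟ᶠ_
    ; _≤?_ = _≼?_
    }

  open FinitePoset isDecPartialOrder public

  ⋖⇒≢ : ∀ {x y} → x ⋖ y → x ≢ y
  ⋖⇒≢ (up   eq _) refl = ℕₚ.1+n≢n (sym eq)
  ⋖⇒≢ (down eq _) refl = ℕₚ.1+n≢n (sym eq)

  between : ∀ {k l z} → l ≡ suc k → k ≤ z → z ≤ l → z ≡ k ⊎ z ≡ l
  between refl k≤z z≤l with ℕₚ.m≤n⇒m<n∨m≡n z≤l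
  ... | inj₁ z<l = inj₁ (ℕₚ.≤-antisym (s≤s⁻¹ z<l) k≤z)
  ... | inj₂ eq  = inj₂ eq

  convex : ∀ {x y z} → x ⋖ y → x ≼ z → z ≼ y → pos z ≡ pos x ⊎ pos z ≡ pos y
  convex {x} {y} {z} (up y≡1+x asc) xz zy with star⇒run xz | star⇒run zy
  ... | inj₁ (x≤z , _) | inj₁ (z≤y , _) = between y≡1+x x≤z z≤y
  ... | inj₁ (x≤z , r) | inj₂ (y≤z , s) with ℕₚ.m≤n⇒m<n∨m≡n y≤z
  ...   | inj₂ eq  = inj₂ (sym eq)
  ...   | inj₁ y<z = ⊥-elim (opposite-runs (x≤z , r) (y≤z , s)
            (ℕₚ.≤-<-trans (ℕₚ.≤-trans (ℕₚ.n≤1+n _) (ℕₚ.≤-reflexive (sym y≡1+x))) y<z) y<z)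
  convex {x} {y} {z} (up y≡1+x asc) xz zy | inj₂ (z≤x , r) | c with ℕₚ.m≤n⇒m<n∨m≡n z≤x
  ...   | inj₂ eq  = inj₁ eq
  ...   | inj₁ z<x with c
  ...     | inj₁ (_ , s) = ⊥-elim (¬both (s (ℕₚ.<-trans z<x x<y) ℕₚ.≤-refl) (r z<x ℕₚ.≤-refl))
    where
    x<y : pos x < pos y
    x<y = ℕₚ.≤-reflexive (sym y≡1+x)
  ...     | inj₂ (y≤z , _) = ⊥-elim (ℕₚ.<⇒≱ (ℕₚ.<-trans z<x (ℕₚ.≤-reflexive (sym y≡1+x))) y≤z)
  convex {x} {y} {z} (down x≡1+y des) xz zy with star⇒run xz | star⇒run zy
  ... | inj₂ (z≤x , _) | inj₂ (y≤z , _) with between x≡1+y y≤z z≤x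
  ...   | inj₁ eq = inj₂ eq
  ...   | inj₂ eq = inj₁ eq
  convex {x} {y} {z} (down x≡1+y des) xz zy | inj₁ (x≤z , r) | c with ℕₚ.m≤n⇒m<n∨m≡n x≤z
  ...   | inj₂ eq  = inj₁ (sym eq)
  ...   | inj₁ x<z with c
  ...     | inj₁ (z≤y , _) = ⊥-elim (ℕₚ.<⇒≱
              (ℕₚ.<-trans (ℕₚ.≤-reflexive (sym x≡1+y)) x<z) z≤y)
  ...     | inj₂ (y≤z , s) = ⊥-elim (opposite-runs (x≤z , r) (y≤z , s) x<z
              (ℕₚ.<-trans (ℕₚ.≤-reflexive (sym x≡1+y)) x<z))
  convex {x} {y} {z} (down x≡1+y des) xz zy | inj₂ (z≤x , r) | inj₁ (z≤y , s)
    with ℕₚ.m≤n⇒m<n∨m≡n z≤y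
  ...   | inj₂ eq  = inj₂ eq
  ...   | inj₁ z<y = ⊥-elim (¬both (s z<y ℕₚ.≤-refl)
            (r (ℕₚ.<-trans z<y (ℕₚ.≤-reflexive (sym x≡1+y))) ℕₚ.≤-refl))

  ⋖⇔covers : ∀ {x y} → (x ⋖ y) ⇔ Covers x y
  ⋖⇔covers {x} {y} = mk⇔ to from
    where
    to : x ⋖ y → Covers x y
    to c = c ◅ ε , ⋖⇒≢ c , λ z xz zy → case convex c xz zy of λ where
      (inj₁ eq) → inj₁ (pos-injective eq)
      (inj₂ eq) → inj₂ (pos-injective eq)
    from : Covers x y → x ⋖ y
    from (ε , x≢y , _) = contradiction refl x≢y
    from (_◅_ {j = z} c zy , _ , h) with h z (c ◅ ε) zy
    ... | inj₁ z≡x = contradiction (sym z≡x) (⋖⇒≢ c)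
    ... | inj₂ refl = c

  -- Since a 0 = 0 and a t = n + 1 are not positions, this also covers the
  -- first and the last segment.
  _∈Segment_ : Fin n → Fin t → Set
  x ∈Segment i = a (toℕ i) ≤ pos x × pos x ≤ a (suc (toℕ i))

  -- Shared elements sit at the positions a 1, …, a (t - 1).
  SharedAt : (ℕ → Set) → Fin n → Set
  SharedAt P x = ∃ λ (k : Fin t) → 1 ≤ toℕ k × P (toℕ k) × pos x ≡ a (toℕ k)

  Shared IsPeak IsValley : Fin n → Set
  Shared   = SharedAt U.U
  IsPeak   = SharedAt Odd
  IsValley = SharedAt Even

  sharedAt? : ∀ {P : ℕ → Set} → (∀ k → Dec (P k)) → ∀ x → Dec (SharedAt P x)
  sharedAt? P? x = any? λ k →
    (1 ℕₚ.≤? toℕ k) ×-dec (P? (toℕ k) ×-dec (pos x ℕₚ.≟ a (toℕ k)))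

  _∈Segment?_ : ∀ x i → Dec (x ∈Segment i)
  x ∈Segment? i = (a (toℕ i) ℕₚ.≤? pos x) ×-dec (pos x ℕₚ.≤? a (suc (toℕ i)))

  peak valley : Fin t → Maybe (Fin n)
  peak   i = Maybe.map proj₁ (dec⇒maybe (any? λ x → (x ∈Segment? i) ×-dec sharedAt? odd?  x))
  valley i = Maybe.map proj₁ (dec⇒maybe (any? λ x → (x ∈Segment? i) ×-dec sharedAt? even? x))

  β : Fin t → ℕ
  β i = lookup α i ∸ 1

  _∈S̆_ : Fin n → Fin t → Set
  x ∈S̆ i = x ∈Segment i × ¬ Shared x

  fromPos : ∀ p → 1 ≤ p → p < sum α → Fin n
  fromPos (suc p) _ 1+p<a = fromℕ< (ℕₚ.∸-monoˡ-≤ 1 1+p<a)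

  pos-fromPos : ∀ p 1≤p p<a → pos (fromPos p 1≤p p<a) ≡ p
  pos-fromPos (suc p) _ 1+p<a = cong suc (toℕ-fromℕ< (ℕₚ.∸-monoˡ-≤ 1 1+p<a))

  Inside : Fin t → ℕ → Set
  Inside i p = a (toℕ i) < p × p < a (suc (toℕ i))

  fromInside : ∀ i p → Inside i p → Fin n
  fromInside i p (lo , hi) =
    fromPos p (ℕₚ.≤-<-trans z≤n lo) (ℕₚ.<-≤-trans hi (a≤sum i))

  1+j<α : ∀ i (j : Fin (β i)) → suc (toℕ j) < lookup α i
  1+j<α i j = go (lookup α i) (toℕ<n j)
    where
    go : ∀ m → toℕ j < m ∸ 1 → suc (toℕ j) < m
    go (suc m) h = s≤s h

  upPos downPos : ∀ i → Fin (β i) → ℕ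
  upPos   i j = a (toℕ i) ℕ.+ suc (toℕ j)
  downPos i j = a (suc (toℕ i)) ∸ suc (toℕ j)

  upPos-inside : ∀ i j → Inside i (upPos i j)
  upPos-inside i j = ℕₚ.m<m+n (a (toℕ i)) (s≤s z≤n) ,
    subst (upPos i j <_) (sym (a-suc i)) (ℕₚ.+-monoʳ-< (a (toℕ i)) (1+j<α i j))

  1+j≤a : ∀ i (j : Fin (β i)) → suc (toℕ j) ≤ a (suc (toℕ i))
  1+j≤a i j = subst (suc (toℕ j) ≤_) (sym (a-suc i))
    (ℕₚ.≤-trans (ℕₚ.<⇒≤ (1+j<α i j)) (ℕₚ.m≤n+m _ (a (toℕ i))))

  downPos-inside : ∀ i j → Inside i (downPos i j)
  downPos-inside i j =
    subst (a (toℕ i) <_) (sym downPos-≡)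
      (ℕₚ.m<m+n (a (toℕ i)) (ℕₚ.m<n⇒0<n∸m (1+j<α i j))) ,
    ℕₚ.∸-monoʳ-< (s≤s z≤n) (1+j≤a i j)
    where
    downPos-≡ : downPos i j ≡ a (toℕ i) ℕ.+ (lookup α i ∸ suc (toℕ j))
    downPos-≡ = trans (cong (_∸ suc (toℕ j)) (a-suc i))
      (ℕₚ.+-∸-assoc (a (toℕ i)) (ℕₚ.<⇒≤ (1+j<α i j)))

  sWithParity : Parity → ∀ i → Fin (β i) → Fin n
  sWithParity 1ℙ i j = fromInside i (upPos i j)   (upPos-inside i j)
  sWithParity 0ℙ i j = fromInside i (downPos i j) (downPos-inside i j)

  -- s i j is the (suc (toℕ j))-th smallest element of S̆ i: by s∈S̆,
  -- s-increasing and s-exhausts below, s i enumerates S̆ i increasingly.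
  s : ∀ i → Fin (β i) → Fin n
  s i = sWithParity (parity (suc (toℕ i))) i

  inside⇒∈S̆ : ∀ i {x} → Inside i (pos x) → x ∈S̆ i
  inside⇒∈S̆ i {x} (lo , hi) = (ℕₚ.<⇒≤ lo , ℕₚ.<⇒≤ hi) , λ (k , _ , _ , eq) →
    case toℕ k ℕₚ.≤? toℕ i of λ where
      (yes k≤i) → ℕₚ.<⇒≱ lo (ℕₚ.≤-trans (ℕₚ.≤-reflexive eq) (a-mono k≤i))
      (no  k≰i) → ℕₚ.<⇒≱ hi (ℕₚ.≤-trans (a-mono (ℕₚ.≰⇒> k≰i)) (ℕₚ.≤-reflexive (sym eq)))

  ∈S̆⇒inside : ∀ i {x} → x ∈S̆ i → Inside i (pos x)
  ∈S̆⇒inside i {x} ((lo , hi) , ¬shared) =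
    ℕₚ.≤∧≢⇒< lo lo≢ , ℕₚ.≤∧≢⇒< hi hi≢
    where
    pos<sum : pos x < sum α
    pos<sum = go (sum α) (toℕ<n x)
      where
      go : ∀ m → toℕ x < m ∸ 1 → pos x < m
      go (suc m) h = s≤s h
    lo≢ : a (toℕ i) ≢ pos x
    lo≢ eq with toℕ i in i≡
    ... | zero = case eq of λ ()
    ... | suc k = ¬shared (i , subst (1 ≤_) (sym i≡) (s≤s z≤n) , _ ,
                           trans (sym eq) (cong a (sym i≡)))
    hi≢ : pos x ≢ a (suc (toℕ i))
    hi≢ eq with ℕₚ.m≤n⇒m<n∨m≡n (toℕ<n i)
    ... | inj₁ 1+i<t = ¬shared (fromℕ< 1+i<t ,
            subst (1 ≤_) (sym (toℕ-fromℕ< 1+i<t)) (s≤s z≤n) , _ ,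
            trans eq (cong a (sym (toℕ-fromℕ< 1+i<t))))
    ... | inj₂ 1+i≡t = ℕₚ.<⇒≢ pos<sum (trans eq (trans (cong a 1+i≡t) a-t))

  pos-sWithParity-1 : ∀ i j → pos (sWithParity 1ℙ i j) ≡ upPos i j
  pos-sWithParity-1 i j = pos-fromPos (upPos i j) _ _

  pos-sWithParity-0 : ∀ i j → pos (sWithParity 0ℙ i j) ≡ downPos i j
  pos-sWithParity-0 i j = pos-fromPos (downPos i j) _ _

  s∈S̆ : ∀ i j → s i j ∈S̆ i
  s∈S̆ i j = go (parity (suc (toℕ i)))
    where
    go : ∀ p → sWithParity p i j ∈S̆ i
    go 1ℙ = inside⇒∈S̆ i (subst (Inside i) (sym (pos-sWithParity-1 i j)) (upPos-inside i j))
    go 0ℙ = inside⇒∈S̆ i (subst (Inside i) (sym (pos-sWithParity-0 i j)) (downPos-inside i j))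

  s-exhausts : ∀ i {x} → x ∈S̆ i → ∃ λ j → s i j ≡ x
  s-exhausts i {x} x∈ = go (parity (suc (toℕ i)))
    where
    lo : a (toℕ i) < pos x
    lo = proj₁ (∈S̆⇒inside i x∈)
    hi : pos x < a (suc (toℕ i))
    hi = proj₂ (∈S̆⇒inside i x∈)
    index : ∀ d → 1 ≤ d → d < lookup α i → ∃ λ (j : Fin (β i)) → suc (toℕ j) ≡ d
    index (suc d) _ h = fromℕ< (ℕₚ.∸-monoˡ-≤ 1 h) , cong suc (toℕ-fromℕ< (ℕₚ.∸-monoˡ-≤ 1 h))
    go : ∀ p → ∃ λ j → sWithParity p i j ≡ x
    go 1ℙ with index (pos x ∸ a (toℕ i)) (ℕₚ.m<n⇒0<n∸m lo)
      (ℕₚ.+-cancelˡ-< (a (toℕ i)) _ _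
        (subst₂ _<_ (sym (ℕₚ.m+[n∸m]≡n (ℕₚ.<⇒≤ lo))) (a-suc i) hi))
    ... | j , eq = j , pos-injective (trans (pos-sWithParity-1 i j)
            (trans (cong (a (toℕ i) ℕ.+_) eq) (ℕₚ.m+[n∸m]≡n (ℕₚ.<⇒≤ lo))))
    go 0ℙ with index (a (suc (toℕ i)) ∸ pos x) (ℕₚ.m<n⇒0<n∸m hi)
      (ℕₚ.+-cancelʳ-< (pos x) _ _
        (subst₂ _<_ (trans a-suc′ (sym (ℕₚ.m∸n+n≡m (ℕₚ.<⇒≤ hi)))) refl
          (subst (_< lookup α i ℕ.+ pos x) (ℕₚ.+-comm (lookup α i) (a (toℕ i)))
            (ℕₚ.+-monoʳ-< (lookup α i) lo))))
      where
      a-suc′ : a (toℕ i) ℕ.+ lookup α i ≡ a (suc (toℕ i))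
      a-suc′ = sym (a-suc i)
    ... | j , eq = j , pos-injective (trans (pos-sWithParity-0 i j)
            (trans (cong (a (suc (toℕ i)) ∸_) eq) (ℕₚ.m∸[m∸n]≡n (ℕₚ.<⇒≤ hi))))

  s-increasing : ∀ i {j k} → toℕ j < toℕ k → s i j ≼ s i k × s i j ≢ s i k
  s-increasing i {j} {k} j<k with parity (suc (toℕ i)) in eq
  ... | 1ℙ = run⇒star (inj₁ (ℕₚ.<⇒≤ lt , λ {m} m<k j≤m →
          i , ℕₚ.≤-trans (ℕₚ.<⇒≤ (proj₁ (in-1 j))) j≤m , ℕₚ.<-trans m<k (proj₂ (in-1 k)) , eq)) ,
        λ s≡ → ℕₚ.<⇒≢ lt (cong pos s≡)
    where
    in-1 : ∀ l → Inside i (pos (sWithParity 1ℙ i l))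
    in-1 l = subst (Inside i) (sym (pos-sWithParity-1 i l)) (upPos-inside i l)
    lt : pos (sWithParity 1ℙ i j) < pos (sWithParity 1ℙ i k)
    lt = subst₂ _<_ (sym (pos-sWithParity-1 i j)) (sym (pos-sWithParity-1 i k))
      (ℕₚ.+-monoʳ-< (a (toℕ i)) (s≤s j<k))
  ... | 0ℙ = run⇒star (inj₂ (ℕₚ.<⇒≤ lt , λ {m} m<j k≤m →
          i , ℕₚ.≤-trans (ℕₚ.<⇒≤ (proj₁ (in-0 k))) k≤m , ℕₚ.<-trans m<j (proj₂ (in-0 j)) , eq)) ,
        λ s≡ → ℕₚ.<⇒≢ lt (cong pos (sym s≡))
    where
    in-0 : ∀ l → Inside i (pos (sWithParity 0ℙ i l))
    in-0 l = subst (Inside i) (sym (pos-sWithParity-0 i l)) (downPos-inside i l)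
    lt : pos (sWithParity 0ℙ i k) < pos (sWithParity 0ℙ i j)
    lt = subst₂ _<_ (sym (pos-sWithParity-0 i k)) (sym (pos-sWithParity-0 i j))
      (ℕₚ.∸-monoʳ-< (s≤s j<k) (1+j≤a i k))

module FenceFunctions (R : CommutativeRing 0ℓ 0ℓ) (α : List ℕ) where

  open CommutativeRing R
  open RawMonoidDefinitions +-rawMonoid using () renaming (_×_ to _·_)
  open Fence α using (β; s; peak; valley; isDecPartialOrder)
  open FinitePoset isDecPartialOrder using (OrderIdeal)
  open ToggleFunctions R isDecPartialOrder public

  -- A missing peak or valley contributes zero.
  χ̂? : Maybe (Fin (Fence.n α)) → OrderIdeal → Carrier
  χ̂? nothing  I = 0#
  χ̂? (just q) I = χ̂ q I

  -- m · x is the m-fold sum of x; the index called j in the usual notation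
  -- is suc (toℕ j) here.
  basisElement : ∀ i → Fin (β i) → OrderIdeal → Carrier
  basisElement i j I =
    (lookup α i · χ̂ (s i j) I
      - suc (toℕ j) · χ̂? (peak i) I)
      - (lookup α i ∸ suc (toℕ j)) · χ̂? (valley i) I

  𝓑 : List (OrderIdeal → Carrier)
  𝓑 = concat (tabulate λ i → tabulate λ j → basisElement i j)

module Submission where

-- Extend the indicators χ̂ to the outer positions 0 and n + 1 by constants, so
-- that every segment becomes a full chain X_0, …, X_w of indicators (w = αᵢ),
-- running from its low-index end to its high-index end. An unshared element at
-- place j of this chain then has T = X_{j-1} - 2 X_j + X_{j+1}, and a subspace
-- containing the constants contains these second differences if and only if it
-- contains the combinations w X_j - j X_w - (w - j) X_0, which up to constants
-- are the proposed basis elements of the segment. So these lie in I_T, and they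
-- span once f ∈ I_T is known to involve no T_r with r shared. For this, let x
-- and y be the neighbours of r, and take the mixed difference of f over four
-- ideals that differ only in whether they contain x and y: it is 0 since f is
-- in the span of the χ̂, while it is ±1 on T_r and 0 on every other T_q.
-- Independence is seen by toggling single unshared elements.

open import Defs
open import Algebra.Bundles using (CommutativeRing)
import Algebra.Properties.AbelianGroup as AbelianGroupProperties
import Algebra.Properties.CommutativeMonoid.Sum as CommutativeMonoidSum
import Algebra.Properties.Ring as RingProperties
import Algebra.Properties.Semiring.Mult as SemiringMult
import Algebra.Properties.Semiring.Mult.TCOptimised as SemiringMult′
import Algebra.Properties.Semiring.Sum as SemiringSum
import Algebra.Solver.Ring
open import Algebra.Solver.Ring.AlmostCommutativeRing
  using (_-Raw-AlmostCommutative⟶_; fromCommutativeRing; Induced-equivalence)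
open import Data.Bool.Base using (Bool; true; false; not; _∧_; if_then_else_)
import Data.Bool.Properties as Boolₚ
open import Data.Empty using (⊥)
open import Data.Fin.Base using (Fin; zero; suc; toℕ; fromℕ<; cast)
open import Data.Fin.Properties using (any?; toℕ<n; toℕ-fromℕ<; toℕ-injective; toℕ-cast)
  renaming (_≟_ to _≟ᶠ_)
open import Data.Fin.Subset using (Subset; _∈_; _∉_; _∩_)
import Data.Fin.Subset as Subset
open import Data.Fin.Subset.Properties using (_∈?_; x∈p∩q⁺; x∈p∩q⁻; ∉⊥)
open import Data.Integer.Base as ℤ using (ℤ; +_; -[1+_]; _⊖_)
import Data.Integer.Properties as ℤₚ
open import Data.List.Base using (List; []; _∷_; lookup; length; map; concat; tabulate)
open import Data.List.Membership.Propositional using () renaming (_∈_ to _∈ᴸ_)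
open import Data.List.Membership.Propositional.Properties
  using (∈-lookup; ∈-concat⁺′; ∈-tabulate⁺; ∈-tabulate⁻)
import Data.List.Properties as Listₚ
import Data.List.Relation.Unary.All as All
import Data.List.Relation.Unary.All.Properties as Allₚ
open import Data.List.Relation.Unary.AllPairs using (_∷_)
import Data.List.Relation.Unary.AllPairs.Properties as AllPairsₚ
import Data.List.Relation.Unary.Any as Any
import Data.List.Relation.Unary.Any.Properties as Anyₚ
open import Data.List.Relation.Unary.Unique.Propositional using (Unique)
import Data.List.Relation.Unary.Unique.Propositional.Properties as Uniqueₚ
open import Data.Maybe.Base using (Maybe; just; nothing)
import Data.Maybe.Base as Maybe
open import Data.Nat.Base as ℕ using (ℕ; zero; suc; _∸_; _≤_; _<_; z≤n; s≤s; s≤s⁻¹; parity)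
open import Data.Nat.ListAction using (sum)
import Data.Nat.Properties as ℕₚ
open import Data.Parity.Base using (Parity; 0ℙ; 1ℙ; _⁻¹)
import Data.Parity.Properties as Parityₚ
open import Data.Product.Base using (∃; _×_; _,_; proj₁; proj₂; uncurry)
open import Data.Rational.Base as ℚ using (ℚ; 0ℚ; 1ℚ)
import Data.Rational.Properties as ℚₚ
open import Data.Sum.Base using (_⊎_; inj₁; inj₂; swap)
import Data.Vec.Base as Vec
import Data.Vec.Properties as Vecₚ
open import Function.Base using (_∘_; case_of_)
open import Function.Bundles using (_⇔_; mk⇔; Equivalence)
open import Function.Construct.Composition using (_⇔-∘_)
open import Level using (0ℓ)
open import Relation.Binary.Construct.Closure.ReflexiveTransitive using (ε; _◅_; _◅◅_)
open import Relation.Binary.Definitions using (WeaklyDecidable; tri<; tri≈; tri>)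
open import Relation.Binary.PropositionalEquality as ≡ using (_≡_; _≢_; subst)
import Relation.Binary.Reasoning.Setoid as SetoidReasoning
open import Relation.Nullary using (¬_; Dec; yes; no; does; contradiction)
open import Relation.Nullary.Decidable
  using (dec-true; dec-false; dec⇒maybe; does-⇔; ¬?; _⊎-dec_; _×-dec_)
open import Relation.Unary using (Decidable)

-- Ring solver with integer coefficients.

-- Cancellation x - x is invisible to a solver whose coefficients are the
-- elements of R, where equality is not decidable; hence integer coefficients.
module IntegerSolver (R : CommutativeRing 0ℓ 0ℓ) where

  open CommutativeRing R hiding (zero)
  open AbelianGroupProperties +-abelianGroup
    using (ε⁻¹≈ε; ⁻¹-∙-comm; ⁻¹-involutive)
  open RingProperties ring using (-‿distribˡ-*; -‿distribʳ-*)
  open SemiringMult′ semiring using (1+×; ×-homo-+; ×1-homo-*) renaming (_×_ to _·_)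
  open SetoidReasoning setoid

  -- The multiple is the optimised one, for which `1 · 1#` computes to `1#`. Hence `con (+ 0)` and
  -- `con (+ 1)` denote `0#` and `1#` in goals without any conversion.
  ⟦_⟧ℤ : ℤ → Carrier
  ⟦ + m      ⟧ℤ = m · 1#
  ⟦ -[1+ m ] ⟧ℤ = - (suc m · 1#)

  -‿cancelˡ : ∀ x y z → (x + y) - (x + z) ≈ y - z
  -‿cancelˡ x y z = begin
    (x + y) - (x + z)         ≈⟨ +-cong (+-comm y x) (⁻¹-∙-comm x z) ⟨
    (y + x) + (- x + - z)     ≈⟨ +-assoc y x _ ⟩
    y + (x + (- x + - z))     ≈⟨ +-congˡ (+-assoc x (- x) (- z)) ⟨
    y + ((x - x) + - z)       ≈⟨ +-congˡ (+-congʳ (-‿inverseʳ x)) ⟩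
    y + (0# + - z)            ≈⟨ +-congˡ (+-identityˡ (- z)) ⟩
    y - z                     ∎

  ⟦⊖⟧ : ∀ m n → ⟦ m ⊖ n ⟧ℤ ≈ m · 1# - n · 1#
  ⟦⊖⟧ zero    zero    = sym (-‿inverseʳ 0#)
  ⟦⊖⟧ zero    (suc n) = sym (+-identityˡ _)
  ⟦⊖⟧ (suc m) zero    = sym (trans (+-congˡ ε⁻¹≈ε) (+-identityʳ _))
  ⟦⊖⟧ (suc m) (suc n) = begin
    ⟦ suc m ⊖ suc n ⟧ℤ              ≡⟨ ≡.cong ⟦_⟧ℤ (ℤₚ.[1+m]⊖[1+n]≡m⊖n m n) ⟩
    ⟦ m ⊖ n ⟧ℤ                      ≈⟨ ⟦⊖⟧ m n ⟩
    m · 1# - n · 1#                 ≈⟨ -‿cancelˡ 1# _ _ ⟨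
    (1# + m · 1#) - (1# + n · 1#)   ≈⟨ +-cong (1+× m 1#) (-‿cong (1+× n 1#)) ⟨
    suc m · 1# - suc n · 1#         ∎

  ⟦⟧-+ : ∀ i j → ⟦ i ℤ.+ j ⟧ℤ ≈ ⟦ i ⟧ℤ + ⟦ j ⟧ℤ
  ⟦⟧-+ (+ m)      (+ n)      = ×-homo-+ 1# m n
  ⟦⟧-+ (+ m)      -[1+ n ]   = ⟦⊖⟧ m (suc n)
  ⟦⟧-+ -[1+ m ]   (+ n)      = trans (⟦⊖⟧ n (suc m)) (+-comm _ _)
  ⟦⟧-+ -[1+ m ]   -[1+ n ]   = begin
    - (suc (suc (m ℕ.+ n)) · 1#)       ≡⟨ ≡.cong (λ k → - (suc k · 1#)) (ℕₚ.+-suc m n) ⟨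
    - ((suc m ℕ.+ suc n) · 1#)         ≈⟨ -‿cong (×-homo-+ 1# (suc m) (suc n)) ⟩
    - (suc m · 1# + suc n · 1#)        ≈⟨ ⁻¹-∙-comm _ _ ⟨
    - (suc m · 1#) - suc n · 1#        ∎

  ⟦⟧-neg : ∀ i → ⟦ ℤ.- i ⟧ℤ ≈ - ⟦ i ⟧ℤ
  ⟦⟧-neg (+ zero)  = sym ε⁻¹≈ε
  ⟦⟧-neg (+ suc m) = refl
  ⟦⟧-neg -[1+ m ]  = sym (⁻¹-involutive _)

  ⟦⟧-* : ∀ i j → ⟦ i ℤ.* j ⟧ℤ ≈ ⟦ i ⟧ℤ * ⟦ j ⟧ℤ
  ⟦⟧-* (+ m)    (+ n)    = trans (reflexive (≡.cong ⟦_⟧ℤ (ℤₚ.+◃n≡+n (m ℕ.* n)))) (×1-homo-* m n)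
  ⟦⟧-* (+ m)    -[1+ n ] = begin
    ⟦ (+ m) ℤ.* -[1+ n ] ⟧ℤ        ≡⟨ ≡.cong ⟦_⟧ℤ (ℤₚ.-◃n≡-n (m ℕ.* suc n)) ⟩
    ⟦ ℤ.- (+ (m ℕ.* suc n)) ⟧ℤ     ≈⟨ ⟦⟧-neg (+ (m ℕ.* suc n)) ⟩
    - ((m ℕ.* suc n) · 1#)         ≈⟨ -‿cong (×1-homo-* m (suc n)) ⟩
    - (m · 1# * (suc n · 1#))      ≈⟨ -‿distribʳ-* _ _ ⟩
    m · 1# * - (suc n · 1#)        ∎
  ⟦⟧-* -[1+ m ] (+ n)    = begin
    ⟦ -[1+ m ] ℤ.* (+ n) ⟧ℤ        ≡⟨ ≡.cong ⟦_⟧ℤ (ℤₚ.-◃n≡-n (suc m ℕ.* n)) ⟩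
    ⟦ ℤ.- (+ (suc m ℕ.* n)) ⟧ℤ     ≈⟨ ⟦⟧-neg (+ (suc m ℕ.* n)) ⟩
    - ((suc m ℕ.* n) · 1#)         ≈⟨ -‿cong (×1-homo-* (suc m) n) ⟩
    - (suc m · 1# * (n · 1#))      ≈⟨ -‿distribˡ-* _ _ ⟩
    - (suc m · 1#) * (n · 1#)      ∎
  ⟦⟧-* -[1+ m ] -[1+ n ] = begin
    (suc m ℕ.* suc n) · 1#             ≈⟨ ×1-homo-* (suc m) (suc n) ⟩
    x * y                              ≈⟨ ⁻¹-involutive _ ⟨
    - - (x * y)                        ≈⟨ -‿cong (-‿distribˡ-* x y) ⟩
    - (- x * y)                        ≈⟨ -‿distribʳ-* (- x) y ⟩
    - x * - y                          ∎
    where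
    x y : Carrier
    x = suc m · 1#
    y = suc n · 1#

  homomorphism : ℤ.+-*-rawRing -Raw-AlmostCommutative⟶ fromCommutativeRing R
  homomorphism = record
    { ⟦_⟧    = ⟦_⟧ℤ
    ; +-homo = ⟦⟧-+
    ; *-homo = ⟦⟧-*
    ; -‿homo = ⟦⟧-neg
    ; 0-homo = refl
    ; 1-homo = refl
    }

  coefficients≟ : WeaklyDecidable (Induced-equivalence homomorphism)
  coefficients≟ i j = Maybe.map (reflexive ∘ ≡.cong ⟦_⟧ℤ) (dec⇒maybe (i ℤₚ.≟ j))

  open Algebra.Solver.Ring ℤ.+-*-rawRing (fromCommutativeRing R) homomorphism coefficients≟
    public using (solve; _:=_; _:+_; _:*_; _:-_; :-_; con)

-- Finite sums and multiples of one.

module FiniteSums (R : CommutativeRing 0ℓ 0ℓ) where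

  open CommutativeRing R hiding (zero)
  open CommutativeMonoidSum +-commutativeMonoid public
    using (∑-distrib-+; sum-cong-≋; sum-replicate-zero) renaming (sum to ∑)
  open SemiringSum semiring public using (*-distribˡ-sum)

  ∑-zero : ∀ {m} (t : Fin m → Carrier) → (∀ k → t k ≈ 0#) → ∑ t ≈ 0#
  ∑-zero {m} t t≈0 = trans (sum-cong-≋ t≈0) (sum-replicate-zero m)

  ∑-only : ∀ {m} k (t : Fin m → Carrier) → (∀ l → l ≢ k → t l ≈ 0#) → ∑ t ≈ t k
  ∑-only zero    t t≈0 =
    trans (+-congˡ (∑-zero (t ∘ suc) λ l → t≈0 (suc l) λ ())) (+-identityʳ _)
  ∑-only (suc k) t t≈0 =
    trans (+-cong (t≈0 zero λ ()) (∑-only k (t ∘ suc) λ l l≢k →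
        t≈0 (suc l) λ { ≡.refl → l≢k ≡.refl }))
      (+-identityˡ _)

module NaturalMultiples (R : CommutativeRing 0ℓ 0ℓ) where

  open CommutativeRing R
  open SemiringMult semiring using (×-assoc-*; ×-congʳ; ×-homo-+) renaming (_×_ to _·_)

  ι : ℕ → Carrier
  ι m = m · 1#

  ·≈ι* : ∀ m x → m · x ≈ ι m * x
  ·≈ι* m x = sym (trans (×-assoc-* m 1# x) (×-congʳ m (*-identityˡ x)))

  ι-+ : ∀ m n → ι (m ℕ.+ n) ≈ ι m + ι n
  ι-+ = ×-homo-+ 1#

  -- Stands for characteristic zero of the scalars: segment lengths have to be divided by, both for
  -- spanning and for independence.
  PositivesInvertible : Set
  PositivesInvertible = ∀ m → 0 < m → ∃ λ u → u * ι m ≈ 1#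

-- Subspaces, linear functionals and spans of functions.

module Linear (R : CommutativeRing 0ℓ 0ℓ) {X : Set} where

  open CommutativeRing R hiding (zero)
  open FunctionSpace R {X}
  open FiniteSums R
  open IntegerSolver R
  open RingProperties ring using (-1*x≈-x)
  open NaturalMultiples R
  open SemiringMult semiring using () renaming (_×_ to _·_)

  record IsSubspace (V : (X → Carrier) → Set) : Set where
    field
      resp : ∀ {f g} → f ≋ g → V f → V g
      0∈   : V (λ _ → 0#)
      +∈   : ∀ {f g} → V f → V g → V (λ x → f x + g x)
      *∈   : ∀ a {f} → V f → V (λ x → a * f x)

    neg∈ : ∀ {f} → V f → V (λ x → - f x)
    neg∈ Vf = resp (λ x → -1*x≈-x _) (*∈ (- 1#) Vf)

    double∈ : ∀ {f} → V f → V (λ x → f x + f x)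
    double∈ Vf = +∈ Vf Vf

    ·∈ : ∀ m {f} → V f → V (λ x → m · f x)
    ·∈ m Vf = resp (λ x → sym (·≈ι* m _)) (*∈ (ι m) Vf)

    ∑∈ : ∀ {m} (g : Fin m → X → Carrier) → (∀ k → V (g k)) → V (λ x → ∑ λ k → g k x)
    ∑∈ {zero}  g Vg = 0∈
    ∑∈ {suc m} g Vg = +∈ (Vg zero) (∑∈ (g ∘ suc) (Vg ∘ suc))

  record IsLinear (φ : (X → Carrier) → Carrier) : Set where
    field
      cong   : ∀ {f g} → f ≋ g → φ f ≈ φ g
      +-homo : ∀ f g → φ (λ x → f x + g x) ≈ φ f + φ g
      *-homo : ∀ a f → φ (λ x → a * f x) ≈ a * φ f

    0-homo : φ (λ _ → 0#) ≈ 0#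
    0-homo = trans (cong λ _ → sym (zeroˡ 0#)) (trans (*-homo 0# (λ _ → 0#)) (zeroˡ _))

    lincomb-homo : ∀ {m} c (b : Fin m → X → Carrier) → φ (lincomb c b) ≈ ∑ λ k → c k * φ (b k)
    lincomb-homo {zero}  c b = 0-homo
    lincomb-homo {suc m} c b =
      trans (+-homo _ (lincomb (c ∘ suc) (b ∘ suc)))
        (+-cong (*-homo (c zero) (b zero)) (lincomb-homo (c ∘ suc) (b ∘ suc)))

  eval-isLinear : ∀ x → IsLinear (λ f → f x)
  eval-isLinear x = record
    { cong   = λ f≋g → f≋g x
    ; +-homo = λ _ _ → refl
    ; *-homo = λ _ _ → refl
    }

  difference-isLinear : ∀ {φ ψ} → IsLinear φ → IsLinear ψ → IsLinear (λ f → φ f - ψ f)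
  difference-isLinear {φ} {ψ} Lφ Lψ = record
    { cong   = λ f≋g → +-cong (L.cong f≋g) (-‿cong (M.cong f≋g))
    ; +-homo = λ f g → trans (+-cong (L.+-homo f g) (-‿cong (M.+-homo f g)))
        (solve 4 (λ a b c d → (a :+ b) :- (c :+ d) := (a :- c) :+ (b :- d)) refl
          (φ f) (φ g) (ψ f) (ψ g))
    ; *-homo = λ a f → trans (+-cong (L.*-homo a f) (-‿cong (M.*-homo a f)))
        (solve 3 (λ a b c → a :* b :- a :* c := a :* (b :- c)) refl a (φ f) (ψ f))
    }
    where
    module L = IsLinear Lφ
    module M = IsLinear Lψ

  lincomb-0 : ∀ {m} (b : Fin m → X → Carrier) → lincomb (λ _ → 0#) b ≋ λ _ → 0#
  lincomb-0 b x = ∑-zero _ λ k → zeroˡ (b k x)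

  lincomb-+ : ∀ {m} c d (b : Fin m → X → Carrier) →
    lincomb (λ k → c k + d k) b ≋ λ x → lincomb c b x + lincomb d b x
  lincomb-+ c d b x = trans (sum-cong-≋ λ k → distribʳ (b k x) (c k) (d k))
    (∑-distrib-+ (λ k → c k * b k x) (λ k → d k * b k x))

  lincomb-* : ∀ {m} a c (b : Fin m → X → Carrier) →
    lincomb (λ k → a * c k) b ≋ λ x → a * lincomb c b x
  lincomb-* a c b x = trans (sum-cong-≋ λ k → *-assoc a (c k) (b k x))
    (sym (*-distribˡ-sum a (λ k → c k * b k x)))

  Span-isSubspace : ∀ {m} (b : Fin m → X → Carrier) → IsSubspace (_∈Span b)
  Span-isSubspace b = record
    { resp = λ f≋g (c , f≋) → c , λ x → trans (sym (f≋g x)) (f≋ x)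
    ; 0∈   = (λ _ → 0#) , λ x → sym (lincomb-0 b x)
    ; +∈   = λ (c , f≋) (d , g≋) → (λ k → c k + d k) ,
        λ x → trans (+-cong (f≋ x) (g≋ x)) (sym (lincomb-+ c d b x))
    ; *∈   = λ a (c , f≋) → (λ k → a * c k) , λ x → trans (*-congˡ (f≋ x)) (sym (lincomb-* a c b x))
    }

  member∈Span : ∀ {m} (b : Fin m → X → Carrier) k → b k ∈Span b
  member∈Span b k = δ , λ x → sym (trans
      (∑-only k _ λ l l≢k → trans (*-congʳ (δ-≢ l l≢k)) (zeroˡ _))
      (trans (*-congʳ δ-≡) (*-identityˡ _)))
    where
    δ : Fin _ → Carrier
    δ l = if does (l ≟ᶠ k) then 1# else 0#
    δ-≢ : ∀ l → l ≢ k → δ l ≈ 0#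
    δ-≢ l l≢k rewrite dec-false (l ≟ᶠ k) l≢k = refl
    δ-≡ : δ k ≈ 1#
    δ-≡ rewrite dec-true (k ≟ᶠ k) ≡.refl = refl

  infix 4 _∈Const+Span_

  -- For the family `T` this unfolds to `_≡const`. Using the same notion for the candidate basis
  -- lets both directions of the segment computation run modulo constants.
  _∈Const+Span_ : ∀ {m} → (X → Carrier) → (Fin m → X → Carrier) → Set
  f ∈Const+Span b = ∃ λ c → ∃ λ cs → f ≋ λ x → c + lincomb cs b x

  const∈Const+Span : ∀ {m} (b : Fin m → X → Carrier) c → (λ _ → c) ∈Const+Span b
  const∈Const+Span b c = c , (λ _ → 0#) ,
    λ x → sym (trans (+-congˡ (lincomb-0 b x)) (+-identityʳ c))

  Span⊆Const+Span : ∀ {m} {b : Fin m → X → Carrier} {f} → f ∈Span b → f ∈Const+Span b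
  Span⊆Const+Span (cs , f≋) = 0# , cs , λ x → trans (f≋ x) (sym (+-identityˡ _))

  Const+Span-isSubspace : ∀ {m} (b : Fin m → X → Carrier) → IsSubspace (_∈Const+Span b)
  Const+Span-isSubspace b = record
    { resp = λ f≋g (c , cs , f≋) → c , cs , λ x → trans (sym (f≋g x)) (f≋ x)
    ; 0∈   = const∈Const+Span b 0#
    ; +∈   = λ (c , cs , f≋) (d , ds , g≋) → c + d , (λ k → cs k + ds k) , λ x →
        trans (+-cong (f≋ x) (g≋ x))
          (trans (solve 4 (λ a b c d → (a :+ b) :+ (c :+ d) := (a :+ c) :+ (b :+ d)) refl
                   c (lincomb cs b x) d (lincomb ds b x))
                 (+-congˡ (sym (lincomb-+ cs ds b x))))
    ; *∈   = λ a (c , cs , f≋) → a * c , (λ k → a * cs k) , λ x →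
        trans (*-congˡ (f≋ x))
          (trans (distribˡ a c _) (+-congˡ (sym (lincomb-* a cs b x))))
    }

  -- Second differences and linear interpolation.

  module SecondDifferences (x : ℕ → X → Carrier) (w : ℕ) where

    -- `second j` is centred at `suc j`. `line j` is `w` times the deviation of `x j` from the
    -- interpolation between `x 0` and `x w`, and `slope j` is its deviation from the line through
    -- `x 0` and `x 1`.
    second line slope : ℕ → X → Carrier
    second j I = (x j I + x (suc (suc j)) I) - (x (suc j) I + x (suc j) I)
    line   j I = (ι w * x j I - ι j * x w I) - (ι w - ι j) * x 0 I
    slope  j I = (x j I - x 0 I) - ι j * (x 1 I - x 0 I)

    line-cong : ∀ {j I W y y₁ y₀} → ι w ≈ W → x j I ≈ y → x w I ≈ y₁ → x 0 I ≈ y₀ →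
      line j I ≈ (W * y - ι j * y₁) - (W - ι j) * y₀
    line-cong W≈ y≈ y₁≈ y₀≈ = +-cong (+-cong (*-cong W≈ y≈) (-‿cong (*-congˡ y₁≈)))
      (-‿cong (*-cong (+-congʳ W≈) y₀≈))

    module _ {V : (X → Carrier) → Set} (V-isSubspace : IsSubspace V) where

      open IsSubspace V-isSubspace

      -- Subtracting an affine function of `j` leaves second differences unchanged, so
      -- `slope (j + 2)` is `2 slope (j + 1) - slope j + second j`; the recursion starts from two
      -- zeros.
      slope∈ : (∀ j → suc j < w → V (second j)) → ∀ j → j ≤ w → V (slope j)
      slope∈ V-second zero       _ = resp (λ I →
        solve 2 (λ a b → con (+ 0) := (a :- a) :- con (+ 0) :* (b :- a)) refl (x 0 I) (x 1 I)) 0∈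
      slope∈ V-second (suc zero) _ = resp (λ I →
        -- `ι 1` unfolds to `1# + 0#`, and the coefficient has to be written in that shape.
        solve 2 (λ a b → con (+ 0) := (b :- a) :- (con (+ 1) :+ con (+ 0)) :* (b :- a)) refl
          (x 0 I) (x 1 I)) 0∈
      slope∈ V-second (suc (suc j)) 2+j≤w = resp (λ I →
        solve 6 (λ a b u v y i →
            ((((v :- a) :- (con (+ 1) :+ i) :* (b :- a)) :+ ((v :- a) :- (con (+ 1) :+ i) :* (b :- a)))
              :+ (:- ((u :- a) :- i :* (b :- a)))) :+ ((u :+ y) :- (v :+ v))
            := (y :- a) :- (con (+ 1) :+ (con (+ 1) :+ i)) :* (b :- a)) refl
          (x 0 I) (x 1 I) (x j I) (x (suc j) I) (x (suc (suc j)) I) (ι j))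
        (+∈ (+∈ (double∈ (slope∈ V-second (suc j) (ℕₚ.<⇒≤ 2+j≤w)))
                (neg∈ (slope∈ V-second j (ℕₚ.<⇒≤ (ℕₚ.<⇒≤ 2+j≤w)))))
            (V-second j 2+j≤w))

      -- `line j` equals `ι w * slope j - ι j * slope w`: the terms with `x 1` cancel.
      second⇒line : (∀ j → suc j < w → V (second j)) → ∀ j → j ≤ w → V (line j)
      second⇒line V-second j j≤w = resp (λ I →
        solve 6 (λ a b u y i k →
            k :* ((u :- a) :- i :* (b :- a)) :+ (:- (i :* ((y :- a) :- k :* (b :- a))))
            := (k :* u :- i :* y) :- (k :- i) :* a) refl
          (x 0 I) (x 1 I) (x j I) (x w I) (ι j) (ι w))
        (+∈ (*∈ (ι w) (slope∈ V-second j j≤w)) (neg∈ (*∈ (ι j) (slope∈ V-second w ℕₚ.≤-refl))))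

      -- Interpolation is affine in `j`, so the second difference of `line` is `ι w` times that of
      -- `x`; the inverse `u` removes the factor.
      line⇒second : (∃ λ u → u * ι w ≈ 1#) → (∀ j → 0 < j → j < w → V (line j)) →
        ∀ j → suc j < w → V (second j)
      line⇒second (u , uw≈1) V-line j 1+j<w = resp (λ I → trans
          (solve 8 (λ a y p q r k i u →
            u :* ((((k :* p :- i :* y) :- (k :- i) :* a)
              :+ ((k :* r :- (con (+ 1) :+ (con (+ 1) :+ i)) :* y)
                 :- (k :- (con (+ 1) :+ (con (+ 1) :+ i))) :* a))
            :+ (:- (((k :* q :- (con (+ 1) :+ i) :* y) :- (k :- (con (+ 1) :+ i)) :* a)
                :+ ((k :* q :- (con (+ 1) :+ i) :* y) :- (k :- (con (+ 1) :+ i)) :* a))))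
            := (u :* k) :* ((p :+ r) :- (q :+ q))) refl
            (x 0 I) (x w I) (x j I) (x (suc j) I) (x (suc (suc j)) I) (ι w) (ι j) u)
          (trans (*-congʳ uw≈1) (*-identityˡ _)))
        (*∈ u (+∈ (+∈ (line∈ j (ℕₚ.<⇒≤ (ℕₚ.<⇒≤ 1+j<w))) (line∈ (suc (suc j)) 1+j<w))
                  (neg∈ (double∈ (line∈ (suc j) (ℕₚ.<⇒≤ 1+j<w))))))
        where
        -- `line` vanishes at `0` and at `w`, which supplies the two places that `V-line` leaves
        -- out.
        line∈ : ∀ j → j ≤ w → V (line j)
        line∈ zero    _     = resp (λ I →
          solve 3 (λ a y k → con (+ 0) := (k :* a :- con (+ 0) :* y) :- (k :- con (+ 0)) :* a) refl
            (x 0 I) (x w I) (ι w)) 0∈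
        line∈ (suc j) 1+j≤w with ℕₚ.m≤n⇒m<n∨m≡n 1+j≤w
        ... | inj₁ 1+j<w = V-line (suc j) (ℕ.s≤s ℕ.z≤n) 1+j<w
        ... | inj₂ ≡.refl = resp (λ I →
          solve 3 (λ a y k → con (+ 0) := (k :* y :- k :* y) :- (k :- k) :* a) refl
            (x 0 I) (x w I) (ι w)) 0∈

-- Positions and segments of a fence.

module FenceStructure (α : List ℕ) (shape : IsFenceShape α) where

  open ≡ using (refl; sym; trans; cong; subst; subst₂)
  open Fence α
  open IsFenceShape shape

  segment-at : ∀ {k} → k < t → ∃ λ (i : Fin t) → toℕ i ≡ k
  segment-at k<t = fromℕ< k<t , toℕ-fromℕ< k<t

  a-step : ∀ {k} → k < t → a k < a (suc k)
  a-step k<t with segment-at k<t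
  ... | i , refl = subst (a (toℕ i) <_) (sym (a-suc i)) (ℕₚ.m<m+n _ (positive i))

  a-strict : ∀ {k l} → k < l → l ≤ t → a k < a l
  a-strict k<l l≤t = ℕₚ.<-≤-trans (a-step (ℕₚ.<-≤-trans k<l l≤t)) (a-mono k<l)

  a-cancel-≤ : ∀ {k l} → k ≤ t → a k ≤ a l → k ≤ l
  a-cancel-≤ k≤t ak≤al = ℕₚ.≮⇒≥ λ l<k → ℕₚ.<⇒≱ (a-strict l<k k≤t) ak≤al

  0<t : 0 < t
  0<t = ℕₚ.<⇒≤ t≥2

  1+n≡a-t : suc n ≡ a t
  1+n≡a-t = trans (ℕₚ.m+[n∸m]≡n (subst (0 <_) a-t (a-strict 0<t ℕₚ.≤-refl))) (sym a-t)

  segmentOf : ∀ k {j} → k ≤ t → j < a k → ∃ λ (i : Fin t) → a (toℕ i) ≤ j × j < a (suc (toℕ i))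
  segmentOf (suc k) {j} k<t j<a with j ℕₚ.<? a k
  ... | yes j<ak = segmentOf k (ℕₚ.<⇒≤ k<t) j<ak
  ... | no  j≮ak with segment-at k<t
  ...   | i , refl = i , ℕₚ.≮⇒≥ j≮ak , j<a

  inSegmentOf-0 : ∀ {P} → InSegmentOf P 0 → P 1
  inSegmentOf-0 {P} (i , ai≤0 , _ , Pi) =
    subst (P ∘ suc) (ℕₚ.n≤0⇒n≡0 (a-cancel-≤ (ℕₚ.<⇒≤ (toℕ<n i)) ai≤0)) Pi

  inSegmentOf-n : ∀ {P k} → InSegmentOf P k → n ≤ k → P t
  inSegmentOf-n {P} (i , _ , k<a , Pi) n≤k = subst P
    (ℕₚ.≤-antisym (toℕ<n i)
      (a-cancel-≤ ℕₚ.≤-refl (ℕₚ.≤-trans (ℕₚ.≤-reflexive (sym 1+n≡a-t)) (ℕₚ.≤-<-trans n≤k k<a)))) Pi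

  -- Membership in an ideal at inner and outer positions.

  data Location (k : ℕ) : Set where
    bottom : k ≡ 0 → Location k
    at     : ∀ q → pos q ≡ k → Location k
    top    : n < k → Location k

  locate : ∀ k → Location k
  locate zero = bottom refl
  locate (suc k) with k ℕₚ.<? n
  ... | yes k<n = at (fromℕ< k<n) (cong suc (toℕ-fromℕ< k<n))
  ... | no  k≮n = top (s≤s (ℕₚ.≮⇒≥ k≮n))

  -- Membership in an ideal, extended to the outer positions 0 and a t = n + 1:
  -- each is put into the ideal if the end of the fence next to it is minimal,
  -- and left out if that end is maximal.
  memberAt : ∀ {k} → OrderIdeal → Location k → Bool
  memberAt I (bottom _) = true
  memberAt I (at q _)   = does (q ∈? set I)
  memberAt I (top _)    = does (even? t)

  member : OrderIdeal → ℕ → Bool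
  member I k = memberAt I (locate k)

  member-pos : ∀ I {q k} → pos q ≡ k → member I k ≡ does (q ∈? set I)
  member-pos I {q} {k} q≡k with locate k
  ... | bottom k≡0 = contradiction (trans q≡k k≡0) λ ()
  ... | at r r≡k rewrite pos-injective {r} {q} (trans r≡k (sym q≡k)) = refl
  ... | top n<k = contradiction (subst (_≤ n) q≡k (toℕ<n q)) (ℕₚ.<⇒≱ n<k)

  member-0 : ∀ I {k} → k ≡ 0 → member I k ≡ true
  member-0 I refl = refl

  member-top : ∀ I {k} → n < k → member I k ≡ does (even? t)
  member-top I {k} n<k with locate k
  ... | bottom refl = contradiction n<k λ ()
  ... | at r refl = contradiction (toℕ<n r) (ℕₚ.<⇒≱ n<k)
  ... | top _ = refl

  odd⇒¬even : ∀ {k} → Odd k → ¬ Even k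
  odd⇒¬even o e with trans (sym o) e
  ... | ()

  -- q is interior to a chain in which the elements next to it, if any, are at
  -- the positions d (below) and u (above).
  record Straight (q : Fin n) (d u : ℕ) : Set where
    field
      lower     : ∀ {r} → r ⋖ q → pos r ≡ d
      lower⁻¹   : ∀ {r} → pos r ≡ d → r ⋖ q
      upper     : ∀ {r} → q ⋖ r → pos r ≡ u
      upper⁻¹   : ∀ {r} → pos r ≡ u → q ⋖ r
      bottomless : (∀ r → pos r ≢ d) → ∀ I → member I d ≡ true
      topless    : (∀ r → pos r ≢ u) → ∀ I → member I u ≡ false

  -- Only missing neighbours need an argument. Below, the missing position is 0, which counts as a
  -- member. Above, an ascent that reaches past `n` lies in the last segment, so `t` is odd and the
  -- outer value is `false`.
  straight-up : ∀ {q k} → pos q ≡ suc k → Ascent k → Ascent (suc k) → Straight q k (suc (suc k))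
  straight-up {q} {k} q≡ ak a1+k = record
    { lower   = λ { (up eq _)   → ℕₚ.suc-injective (trans (sym eq) q≡)
                  ; (down eq d) → contradiction (subst Descent q≡ d) (¬both a1+k) }
    ; lower⁻¹ = λ r≡ → up (trans q≡ (cong suc (sym r≡))) (subst Ascent (sym r≡) ak)
    ; upper   = λ { (up eq _)   → trans eq (cong suc q≡)
                  ; (down eq d) →
                      contradiction (subst Descent (ℕₚ.suc-injective (trans (sym eq) q≡)) d) (¬both ak) }
    ; upper⁻¹ = λ r≡ → up (trans r≡ (cong suc (sym q≡))) (subst Ascent (sym q≡) a1+k)
    ; bottomless = λ none I → below none I (locate k)
    ; topless    = λ none I → above none I (locate (suc (suc k)))
    }
    where
    below : (∀ r → pos r ≢ k) → ∀ I → Location k → member I k ≡ true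
    below none I (bottom k≡0) = member-0 I k≡0
    below none I (at r r≡k)   = contradiction r≡k (none r)
    below none I (top n<k)    = contradiction (subst (_≤ n) q≡ (toℕ<n q)) (ℕₚ.<⇒≱ (ℕₚ.m≤n⇒m≤1+n n<k))
    above : (∀ r → pos r ≢ suc (suc k)) → ∀ I → Location (suc (suc k)) → member I (suc (suc k)) ≡ false
    above none I (at r r≡)   = contradiction r≡ (none r)
    above none I (top n<2+k) = trans (member-top I n<2+k)
      (dec-false (even? t) (odd⇒¬even {t} (inSegmentOf-n {Odd} a1+k (s≤s⁻¹ n<2+k))))

  straight-down : ∀ {q k} → pos q ≡ suc k → Descent k → Descent (suc k) → Straight q (suc (suc k)) k
  straight-down {q} {k} q≡ dk d1+k = record
    { lower   = λ { (down eq _) → trans eq (cong suc q≡)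
                  ; (up eq a)   →
                      contradiction dk (¬both (subst Ascent (ℕₚ.suc-injective (trans (sym eq) q≡)) a)) }
    ; lower⁻¹ = λ r≡ → down (trans r≡ (cong suc (sym q≡))) (subst Descent (sym q≡) d1+k)
    ; upper   = λ { (down eq _) → ℕₚ.suc-injective (trans (sym eq) q≡)
                  ; (up eq a)   → contradiction d1+k (¬both (subst Ascent q≡ a)) }
    ; upper⁻¹ = λ r≡ → down (trans q≡ (cong suc (sym r≡))) (subst Descent (sym r≡) dk)
    ; bottomless = λ none I → below none I (locate (suc (suc k)))
    ; topless    = λ none I → above none I (locate k)
    }
    where
    below : (∀ r → pos r ≢ suc (suc k)) → ∀ I → Location (suc (suc k)) → member I (suc (suc k)) ≡ true
    below none I (at r r≡)   = contradiction r≡ (none r)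
    below none I (top n<2+k) = trans (member-top I n<2+k)
      (dec-true (even? t) (inSegmentOf-n {Even} d1+k (s≤s⁻¹ n<2+k)))
    above : (∀ r → pos r ≢ k) → ∀ I → Location k → member I k ≡ false
    -- Position 0 belongs to the first segment, whose number 1 is odd, so no descent starts there.
    above none I (bottom refl) = contradiction (inSegmentOf-0 {Even} dk) λ ()
    above none I (at r r≡k)    = contradiction r≡k (none r)
    above none I (top n<k)     =
      contradiction (subst (_≤ n) q≡ (toℕ<n q)) (ℕₚ.<⇒≱ (ℕₚ.m≤n⇒m≤1+n n<k))

  -- A chain from a smaller element up to `q` ends with a lower cover of `q`. Once that cover is in
  -- `I`, downward closure puts the whole chain below it into `I`.
  isMinimalOutside⇔ : ∀ {q} I → IsMinimalOutside q (set I) ⇔ (q ∉ set I × (∀ r → r ⋖ q → r ∈ set I))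
  isMinimalOutside⇔ {q} I = mk⇔ to from
    where
    to : IsMinimalOutside q (set I) → q ∉ set I × (∀ r → r ⋖ q → r ∈ set I)
    to (q∉I , min) = q∉I , λ r r⋖q → case-∈ r r⋖q (r ∈? set I)
      where
      case-∈ : ∀ r → r ⋖ q → Dec (r ∈ set I) → r ∈ set I
      case-∈ r r⋖q (yes r∈I) = r∈I
      case-∈ r r⋖q (no  r∉I) = contradiction (min r r∉I (r⋖q ◅ ε)) (⋖⇒≢ r⋖q)
    from : q ∉ set I × (∀ r → r ⋖ q → r ∈ set I) → IsMinimalOutside q (set I)
    from (q∉I , lower) = q∉I , λ p p∉I p≼q → go p∉I p≼q
      where
      strict : ∀ {p y} → p ⋖ y → y ≼ q → p ∈ set I
      strict c ε       = lower _ c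
      strict c (d ◅ r) = isLower I (strict d r) (c ◅ ε)
      go : ∀ {p} → p ∉ set I → p ≼ q → p ≡ q
      go p∉I ε       = refl
      go p∉I (c ◅ r) = contradiction (strict c r) p∉I

  isMaximalIn⇔ : ∀ {q} I → IsMaximalIn q (set I) ⇔ (q ∈ set I × (∀ r → q ⋖ r → r ∉ set I))
  isMaximalIn⇔ {q} I = mk⇔
    (λ (q∈I , max) → q∈I , λ r q⋖r r∈I → ⋖⇒≢ q⋖r (sym (max r r∈I (q⋖r ◅ ε))))
    (λ (q∈I , upper) → q∈I , λ
      { p p∈I ε       → refl
      ; p p∈I (c ◅ r) → contradiction (isLower I p∈I r) (upper _ c) })

  ∧-⇔ : ∀ {A B : Set} {b c} → A ⇔ (b ≡ true) → B ⇔ (c ≡ true) → (A × B) ⇔ (b ∧ c ≡ true)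
  ∧-⇔ {b = true}  A⇔ B⇔ = mk⇔ (λ (_ , y) → Equivalence.to B⇔ y)
    (λ eq → Equivalence.from A⇔ refl , Equivalence.from B⇔ eq)
  ∧-⇔ {b = false} A⇔ B⇔ = mk⇔ (λ (x , _) → Equivalence.to A⇔ x) λ ()

  does≡ : ∀ {A : Set} {b} (a? : Dec A) → A ⇔ (b ≡ true) → does a? ≡ b
  does≡ {b = true}  a? A⇔ = dec-true a? (Equivalence.from A⇔ refl)
  does≡ {b = false} a? A⇔ = dec-false a? λ x → contradiction (Equivalence.to A⇔ x) λ ()

  does⇔ : ∀ {A : Set} (a? : Dec A) → A ⇔ (does a? ≡ true)
  does⇔ (yes x) = mk⇔ (λ _ → refl) (λ _ → x)
  does⇔ (no ¬x) = mk⇔ (λ x → contradiction x ¬x) λ ()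

  ¬does⇔ : ∀ {A : Set} (a? : Dec A) → (¬ A) ⇔ (not (does a?) ≡ true)
  ¬does⇔ (yes x) = mk⇔ (λ ¬x → contradiction x ¬x) λ ()
  ¬does⇔ (no ¬x) = mk⇔ (λ _ → refl) (λ _ → ¬x)

  position? : ∀ k → (∃ λ q → pos q ≡ k) ⊎ (∀ q → pos q ≢ k)
  position? k with locate k
  ... | bottom refl = inj₂ λ _ ()
  ... | at q q≡k    = inj₁ (q , q≡k)
  ... | top n<k     = inj₂ λ q q≡k → ℕₚ.<⇒≱ n<k (subst (_≤ n) q≡k (toℕ<n q))

  module _ {q d u} (straight : Straight q d u) (I : OrderIdeal) where

    open Straight straight

    lower⇔ : (∀ r → r ⋖ q → r ∈ set I) ⇔ (member I d ≡ true)
    lower⇔ with position? d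
    ... | inj₂ none = mk⇔ (λ _ → bottomless none I) (λ _ r r⋖q → contradiction (lower r⋖q) (none r))
    ... | inj₁ (p , p≡d) = mk⇔
      (λ h → trans (member-pos I p≡d) (dec-true (p ∈? set I) (h p (lower⁻¹ p≡d))))
      (λ eq r r⋖q → Equivalence.from (does⇔ (r ∈? set I))
        (trans (sym (member-pos I (lower r⋖q))) eq))

    upper⇔ : (∀ r → q ⋖ r → r ∉ set I) ⇔ (not (member I u) ≡ true)
    upper⇔ with position? u
    ... | inj₂ none = mk⇔ (λ _ → cong not (topless none I)) (λ _ r q⋖r → contradiction (upper q⋖r) (none r))
    ... | inj₁ (p , p≡u) = mk⇔
      (λ h → cong not (trans (member-pos I p≡u) (dec-false (p ∈? set I) (h p (upper⁻¹ p≡u)))))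
      (λ eq r q⋖r → Equivalence.from (¬does⇔ (r ∈? set I))
        (trans (cong not (sym (member-pos I (upper q⋖r)))) eq))

    minimalOutside≡ :
      does (isMinimalOutside? q (set I)) ≡ not (does (q ∈? set I)) ∧ member I d
    minimalOutside≡ = does≡ (isMinimalOutside? q (set I))
      (∧-⇔ (¬does⇔ (q ∈? set I)) lower⇔ ⇔-∘ isMinimalOutside⇔ I)

    maximalIn≡ : does (isMaximalIn? q (set I)) ≡ does (q ∈? set I) ∧ not (member I u)
    maximalIn≡ = does≡ (isMaximalIn? q (set I))
      (∧-⇔ (does⇔ (q ∈? set I)) upper⇔ ⇔-∘ isMaximalIn⇔ I)

    member-below : does (q ∈? set I) ≡ true → member I d ≡ true
    member-below q∈ = Equivalence.to lower⇔ λ r r⋖q →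
      isLower I (Equivalence.from (does⇔ (q ∈? set I)) q∈) (r⋖q ◅ ε)

    member-above : does (q ∈? set I) ≡ false → member I u ≡ false
    member-above q∉ = Boolₚ.not-injective (Equivalence.to upper⇔ λ r q⋖r r∈I →
      Equivalence.from (¬does⇔ (q ∈? set I)) (cong not q∉) (isLower I r∈I (q⋖r ◅ ε)))

  at-position : ∀ k → 0 < k → k ≤ n → ∃ λ q → pos q ≡ k
  at-position k 0<k k≤n with locate k
  ... | bottom refl = contradiction 0<k λ ()
  ... | at q q≡k    = q , q≡k
  ... | top n<k     = contradiction k≤n (ℕₚ.<⇒≱ n<k)

  -- Shared elements, segment ends and the enumeration of unshared elements.

  shared? : ∀ q → Dec (Shared q)
  shared? = sharedAt? (λ _ → yes _)

  unshared⇒inside : ∀ {q} → ¬ Shared q → ∃ λ i → Inside i (pos q)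
  unshared⇒inside {q} ¬shared
    with segmentOf t ℕₚ.≤-refl (subst (pos q <_) 1+n≡a-t (s≤s (toℕ<n q)))
  ... | i , lo , hi = i , ∈S̆⇒inside i ((lo , ℕₚ.<⇒≤ hi) , ¬shared)

  inside-steps : ∀ {P i k} → Inside i (suc k) → P (suc (toℕ i)) → InSegmentOf P k × InSegmentOf P (suc k)
  inside-steps {i = i} {k} (lo , hi) Pi =
    (i , s≤s⁻¹ lo , ℕₚ.<⇒≤ hi , Pi) , (i , ℕₚ.<⇒≤ lo , hi , Pi)

  parity-consecutive : ∀ k → parity k ≢ parity (suc k)
  parity-consecutive k eq = Parityₚ.p≢p⁻¹ (parity (suc k)) (sym (trans (Parityₚ.suc-homo-⁻¹ k) eq))

  -- `peak i` and `valley i` unfold to `endpoint 1ℙ i` and `endpoint 0ℙ i`, so one analysis of the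
  -- search serves both.
  endpoint : Parity → Fin t → Maybe (Fin n)
  endpoint π i = Maybe.map proj₁
    (dec⇒maybe (any? λ x → (x ∈Segment? i) ×-dec sharedAt? (λ k → parity k Parityₚ.≟ π) x))

  data Endpoint (e : ℕ) : Maybe (Fin n) → Set where
    present : ∀ {x} → Shared x → pos x ≡ a e → Endpoint e (just x)
    absent  : e ≡ 0 ⊎ e ≡ t → Endpoint e nothing

  -- A shared element of the segment sits at one of its two ends, and the indices of these have
  -- opposite parity, so the search can only find the element at `a e`. It fails only if `a e` is no
  -- shared position, that is, at an outer end of the fence.
  endpoint-at : ∀ π i {e} → e ≡ toℕ i ⊎ e ≡ suc (toℕ i) → parity e ≡ π → Endpoint e (endpoint π i)
  endpoint-at π i {e} e≡ e-parity
    with any? (λ x → (x ∈Segment? i) ×-dec sharedAt? (λ k → parity k Parityₚ.≟ π) x)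
  ... | yes (x , (lo , hi) , k , 1≤k , k-parity , x≡) =
    present (k , 1≤k , _ , x≡) (trans x≡ (cong a (end-unique e≡ k≡)))
    where
    i≤k : toℕ i ≤ toℕ k
    i≤k = a-cancel-≤ (ℕₚ.<⇒≤ (toℕ<n i)) (subst (a (toℕ i) ≤_) x≡ lo)
    k≤1+i : toℕ k ≤ suc (toℕ i)
    k≤1+i = a-cancel-≤ (ℕₚ.<⇒≤ (toℕ<n k)) (subst (_≤ a (suc (toℕ i))) x≡ hi)
    k≡ : toℕ k ≡ toℕ i ⊎ toℕ k ≡ suc (toℕ i)
    k≡ = between refl i≤k k≤1+i
    same-parity : parity (toℕ k) ≡ parity e
    same-parity = trans k-parity (sym e-parity)
    end-unique : e ≡ toℕ i ⊎ e ≡ suc (toℕ i) → toℕ k ≡ toℕ i ⊎ toℕ k ≡ suc (toℕ i) → toℕ k ≡ e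
    end-unique (inj₁ e≡) (inj₁ k≡) = trans k≡ (sym e≡)
    end-unique (inj₂ e≡) (inj₂ k≡) = trans k≡ (sym e≡)
    end-unique (inj₁ e≡) (inj₂ k≡) = contradiction
      (trans (cong parity (sym e≡)) (trans (sym same-parity) (cong parity k≡))) (parity-consecutive (toℕ i))
    end-unique (inj₂ e≡) (inj₁ k≡) = contradiction
      (trans (cong parity (sym k≡)) (trans same-parity (cong parity e≡))) (parity-consecutive (toℕ i))
  ... | no none = absent (outer e≡ (e ℕₚ.≟ 0))
    where
    e≤t : e ≡ toℕ i ⊎ e ≡ suc (toℕ i) → e ≤ t
    e≤t (inj₁ refl) = ℕₚ.<⇒≤ (toℕ<n i)
    e≤t (inj₂ refl) = toℕ<n i
    in-segment : ∀ {x} → pos x ≡ a e → e ≡ toℕ i ⊎ e ≡ suc (toℕ i) → x ∈Segment i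
    in-segment x≡ (inj₁ refl) =
      ℕₚ.≤-reflexive (sym x≡) , subst (_≤ a (suc (toℕ i))) (sym x≡) (a-mono (ℕₚ.n≤1+n (toℕ i)))
    in-segment x≡ (inj₂ refl) =
      subst (a (toℕ i) ≤_) (sym x≡) (a-mono (ℕₚ.n≤1+n (toℕ i))) , ℕₚ.≤-reflexive x≡
    outer : e ≡ toℕ i ⊎ e ≡ suc (toℕ i) → Dec (e ≡ 0) → e ≡ 0 ⊎ e ≡ t
    outer e≡ (yes e≡0) = inj₁ e≡0
    outer e≡ (no e≢0) with ℕₚ.m≤n⇒m<n∨m≡n (e≤t e≡)
    ... | inj₂ e≡t = inj₂ e≡t
    ... | inj₁ e<t = contradiction
      (x , in-segment x≡ e≡ , k , subst (1 ≤_) (sym k≡e) 0<e , trans (cong parity k≡e) e-parity ,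
       trans x≡ (cong a (sym k≡e))) none
      where
      0<e : 0 < e
      0<e = ℕₚ.n≢0⇒n>0 e≢0
      k : Fin t
      k = proj₁ (segment-at e<t)
      k≡e : toℕ k ≡ e
      k≡e = proj₂ (segment-at e<t)
      ae<sum : a e < sum α
      ae<sum = subst (a e <_) a-t (a-strict e<t ℕₚ.≤-refl)
      x : Fin n
      x = fromPos (a e) (a-strict 0<e (ℕₚ.<⇒≤ e<t)) ae<sum
      x≡ : pos x ≡ a e
      x≡ = pos-fromPos (a e) _ _

  pos-s-odd : ∀ i j → Odd (suc (toℕ i)) → pos (s i j) ≡ a (toℕ i) ℕ.+ suc (toℕ j)
  pos-s-odd i j odd = trans (cong (λ π → pos (sWithParity π i j)) odd) (pos-sWithParity-1 i j)

  pos-s-even : ∀ i j → Even (suc (toℕ i)) →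
    pos (s i j) ≡ a (toℕ i) ℕ.+ (lookup α i ∸ suc (toℕ j))
  pos-s-even i j even = trans (cong (λ π → pos (sWithParity π i j)) even)
    (trans (pos-sWithParity-0 i j) (trans (cong (_∸ suc (toℕ j)) (a-suc i))
      (ℕₚ.+-∸-assoc (a (toℕ i)) (ℕₚ.<⇒≤ (1+j<α i j)))))

  s-unshared : ∀ i j → ¬ Shared (s i j)
  s-unshared i j = proj₂ (s∈S̆ i j)

  s-injective-segment : ∀ {i i′ j j′} → s i j ≡ s i′ j′ → i ≡ i′
  s-injective-segment {i} {i′} {j} {j′} eq = toℕ-injective (same-segment i i′
    (ℕₚ.<⇒≤ (proj₁ inside)) (proj₂ inside) (ℕₚ.<⇒≤ (proj₁ inside′)) (proj₂ inside′))
    where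
    inside : Inside i (pos (s i j))
    inside = ∈S̆⇒inside i (s∈S̆ i j)
    inside′ : Inside i′ (pos (s i j))
    inside′ = subst (Inside i′ ∘ pos) (sym eq) (∈S̆⇒inside i′ (s∈S̆ i′ j′))

  s-injective-segment-at : ∀ i {j j′} → s i j ≡ s i j′ → j ≡ j′
  s-injective-segment-at i {j} {j′} eq with ℕₚ.<-cmp (toℕ j) (toℕ j′)
  ... | tri< j<j′ _ _ = contradiction eq (proj₂ (s-increasing i j<j′))
  ... | tri≈ _ j≡j′ _ = toℕ-injective j≡j′
  ... | tri> _ _ j′<j = contradiction (sym eq) (proj₂ (s-increasing i j′<j))

  s-injective : ∀ {c d : ∃ λ i → Fin (β i)} → uncurry s c ≡ uncurry s d → c ≡ d
  s-injective {i , j} {i′ , j′} eq with s-injective-segment {i} {i′} {j} {j′} eq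
  ... | refl = cong (i ,_) (s-injective-segment-at i eq)

  -- The two neighbours of a shared element.

  ⋖⇒adjacent : ∀ {p q} → p ⋖ q → pos p ≡ suc (pos q) ⊎ pos q ≡ suc (pos p)
  ⋖⇒adjacent (up eq _)   = inj₂ eq
  ⋖⇒adjacent (down eq _) = inj₁ eq

  data Neighbours (r x y : Fin n) : Set where
    peak-of   : x ⋖ r → y ⋖ r → Neighbours r x y
    valley-of : r ⋖ x → r ⋖ y → Neighbours r x y

  -- Both neighbours exist because the first and the last part are at least 2, which keeps `pos r`
  -- between 2 and `n - 1`. The segments meeting at `r` have consecutive numbers, so one ascends and
  -- the other descends.
  shared-neighbours : ∀ {r} → Shared r →
    ∃ λ x → ∃ λ y → pos r ≡ suc (pos x) × pos y ≡ suc (pos r) × Neighbours r x y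
  shared-neighbours {r} (k , 1≤k , _ , r≡) with toℕ k | toℕ<n k | 1≤k
  ... | suc m | k<t | s≤s _ = x , y , r≡1+x , y≡1+r , neighbours (parity (suc m)) refl
    where
    2≤r : 2 ≤ pos r
    2≤r = subst (2 ≤_) (sym r≡) (ℕₚ.≤-trans 2≤a1 (a-mono {1} (s≤s z≤n)))
      where
      2≤a1 : 2 ≤ a 1
      2≤a1 with segment-at 0<t
      ... | i , i≡0 = subst (λ k → 2 ≤ a (suc k)) i≡0 (subst (2 ≤_) (sym (a-suc i))
              (ℕₚ.≤-trans (first≥2 i i≡0) (ℕₚ.m≤n+m _ _)))
    1+r≤n : suc (pos r) ≤ n
    1+r≤n = s≤s⁻¹ (subst₂ _≤_ (cong (λ z → suc (suc z)) (sym r≡)) (sym 1+n≡a-t) (go t refl k<t))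
      where
      go : ∀ u → u ≡ t → suc m < u → suc (suc (a (suc m))) ≤ a t
      go (suc u) 1+u≡t 1+m<1+u with segment-at (subst (u <_) 1+u≡t ℕₚ.≤-refl)
      ... | i , refl = subst (λ u → suc (suc (a (suc m))) ≤ a u) 1+u≡t
        (subst₂ _≤_ (ℕₚ.+-comm _ 2) (sym (a-suc i))
          (ℕₚ.+-mono-≤ (a-mono {suc m} (s≤s⁻¹ 1+m<1+u)) (last≥2 i 1+u≡t)))
    x y : Fin n
    x = proj₁ (at-position (toℕ r) (s≤s⁻¹ 2≤r) (ℕₚ.<⇒≤ (toℕ<n r)))
    y = proj₁ (at-position (suc (pos r)) (s≤s z≤n) 1+r≤n)
    r≡1+x : pos r ≡ suc (pos x)
    r≡1+x = cong suc (sym (proj₂ (at-position (toℕ r) (s≤s⁻¹ 2≤r) (ℕₚ.<⇒≤ (toℕ<n r)))))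
    y≡1+r : pos y ≡ suc (pos r)
    y≡1+r = proj₂ (at-position (suc (pos r)) (s≤s z≤n) 1+r≤n)
    -- The break point `suc m` closes the segment with zero-based index `m`, usually numbered
    -- `suc m`, and opens the one usually numbered `suc (suc m)`.
    before : ∀ (P : ℕ → Set) → P (suc m) → InSegmentOf P (pos x)
    before P P1+m with segment-at (ℕₚ.<⇒≤ k<t)
    ... | i , refl = i , s≤s⁻¹ (subst (a m <_) (trans (sym r≡) r≡1+x) (a-step (ℕₚ.<⇒≤ k<t))) ,
      ℕₚ.≤-reflexive (trans (sym r≡1+x) r≡) , P1+m
    after : ∀ (P : ℕ → Set) → P (suc (suc m)) → InSegmentOf P (pos r)
    after P P2+m with segment-at k<t
    ... | i , i≡ = i , ℕₚ.≤-reflexive (trans (cong a i≡) (sym r≡)) ,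
      subst₂ _<_ (sym r≡) (cong (λ k → a (suc k)) (sym i≡)) (a-step k<t) ,
      subst (λ k → P (suc k)) (sym i≡) P2+m
    neighbours : ∀ π → parity (suc m) ≡ π → Neighbours r x y
    neighbours 1ℙ odd  = peak-of (up r≡1+x (before Odd odd))
      (down y≡1+r (after Even (trans (sym (Parityₚ.suc-homo-⁻¹ m)) (cong _⁻¹ odd))))
    neighbours 0ℙ even = valley-of (down r≡1+x (before Even even))
      (up y≡1+r (after Odd (trans (sym (Parityₚ.suc-homo-⁻¹ m)) (cong _⁻¹ even))))

  -- Test ideals that differ in one or two elements.

  private
    subset : {P : Fin n → Set} → Decidable P → Subset n
    subset P? = Vec.tabulate (does ∘ P?)

    ∈-subset : {P : Fin n → Set} (P? : Decidable P) → ∀ {p} → p ∈ subset P? ⇔ P p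
    ∈-subset P? {p} = mk⇔
      (λ p∈ → Equivalence.from (does⇔ (P? p))
        (trans (sym (Vecₚ.lookup∘tabulate (does ∘ P?) p)) (Vecₚ.[]=⇒lookup p∈)))
      (λ Pp → Vecₚ.lookup⇒[]= p (subset P?)
        (trans (Vecₚ.lookup∘tabulate (does ∘ P?) p) (dec-true (P? p) Pp)))

  infixr 7 _⊓_

  _⊓_ : OrderIdeal → OrderIdeal → OrderIdeal
  I ⊓ J = mkIdeal (set I ∩ set J) λ q∈ p≼q →
    let q∈I , q∈J = x∈p∩q⁻ (set I) (set J) q∈
    in x∈p∩q⁺ (isLower I q∈I p≼q , isLower J q∈J p≼q)

  ∅ : OrderIdeal
  ∅ = mkIdeal Subset.⊥ λ q∈⊥ → contradiction q∈⊥ ∉⊥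

  InCut : Fin n → Bool → Fin n → Set
  InCut x b p = ¬ (x ≼ p) ⊎ (p ≡ x × b ≡ true)

  inCut? : ∀ x b → Decidable (InCut x b)
  inCut? x b p = ¬? (x ≼? p) ⊎-dec ((p ≟ᶠ x) ×-dec (b Boolₚ.≟ true))

  abstract

    -- The largest ideal without x, with x added when b is true.
    cut : Fin n → Bool → OrderIdeal
    cut x b = mkIdeal (subset (inCut? x b)) λ {p} {q} q∈ p≼q →
      Equivalence.from (∈-subset (inCut? x b)) (lower p≼q (Equivalence.to (∈-subset (inCut? x b)) q∈))
      where
      lower : ∀ {p q} → p ≼ q → InCut x b q → InCut x b p
      lower p≼q (inj₁ x⋠q) = inj₁ λ x≼p → x⋠q (x≼p ◅◅ p≼q)
      -- An element strictly below `x` is not above `x`, by antisymmetry, so adding `x` keeps the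
      -- set closed downwards.
      lower {p} p≼q (inj₂ (refl , b≡true)) with p ≟ᶠ x
      ... | yes p≡x = inj₂ (p≡x , b≡true)
      ... | no  p≢x = inj₁ λ x≼p → p≢x (≼-antisym p≼q x≼p)

    ∈-cut : ∀ {x b p} → p ∈ set (cut x b) ⇔ InCut x b p
    ∈-cut {x} {b} = ∈-subset (inCut? x b)

  x∈cut⇔ : ∀ {x b} → x ∈ set (cut x b) ⇔ (b ≡ true)
  x∈cut⇔ = mk⇔
    (λ x∈ → case (Equivalence.to ∈-cut x∈) of λ where
      (inj₁ x⋠x)    → contradiction ε x⋠x
      (inj₂ (_ , b)) → b)
    (λ b → Equivalence.from ∈-cut (inj₂ (refl , b)))

  ⋠⇒∈cut : ∀ {x b p} → ¬ (x ≼ p) → p ∈ set (cut x b)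
  ⋠⇒∈cut x⋠p = Equivalence.from ∈-cut (inj₁ x⋠p)

  ≺⇒∉cut : ∀ {x b p} → x ≼ p → p ≢ x → p ∉ set (cut x b)
  ≺⇒∉cut x≼p p≢x p∈ with Equivalence.to ∈-cut p∈
  ... | inj₁ x⋠p       = x⋠p x≼p
  ... | inj₂ (p≡x , _) = p≢x p≡x

  AgreeOff : Fin n → OrderIdeal → OrderIdeal → Set
  AgreeOff x I J = ∀ p → p ≢ x → p ∈ set I ⇔ p ∈ set J

  agreeOff-sym : ∀ {x I J} → AgreeOff x I J → AgreeOff x J I
  agreeOff-sym agree p p≢x = mk⇔ (Equivalence.from (agree p p≢x)) (Equivalence.to (agree p p≢x))

  cut-agree : ∀ x b c → AgreeOff x (cut x b) (cut x c)
  cut-agree x b c p p≢x = mk⇔ go go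
    where
    go : ∀ {b c} → p ∈ set (cut x b) → p ∈ set (cut x c)
    go p∈ with Equivalence.to ∈-cut p∈
    ... | inj₁ x⋠p       = ⋠⇒∈cut x⋠p
    ... | inj₂ (p≡x , _) = contradiction p≡x p≢x

  agreeOff-⊓ : ∀ {x I I′ J J′} → AgreeOff x I I′ → AgreeOff x J J′ → AgreeOff x (I ⊓ J) (I′ ⊓ J′)
  agreeOff-⊓ {I = I} {I′} {J} {J′} f g p p≢x = mk⇔
    (λ p∈ → let p∈I , p∈J = x∈p∩q⁻ (set I) (set J) p∈
            in x∈p∩q⁺ (Equivalence.to (f p p≢x) p∈I , Equivalence.to (g p p≢x) p∈J))
    (λ p∈ → let p∈I , p∈J = x∈p∩q⁻ (set I′) (set J′) p∈
            in x∈p∩q⁺ (Equivalence.from (f p p≢x) p∈I , Equivalence.from (g p p≢x) p∈J))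

  agreeOff-refl : ∀ {x I} → AgreeOff x I I
  agreeOff-refl p _ = mk⇔ (λ p∈ → p∈) (λ p∈ → p∈)

  Far : Fin n → Fin n → Set
  Far x q = x ≢ q × ¬ (x ⋖ q) × ¬ (q ⋖ x)

  -- By the cover criterion only `q` and its lower covers matter, and all of them differ from `x`
  -- when `x` is far from `q`.
  isMinimalOutside-local : ∀ {x q I J} → Far x q → AgreeOff x I J →
    IsMinimalOutside q (set I) ⇔ IsMinimalOutside q (set J)
  isMinimalOutside-local {x} {q} {I} {J} far agree =
    mk⇔ (go {I} {J} agree) (go {J} {I} (agreeOff-sym {x} {I} {J} agree))
    where
    go : ∀ {I J} → AgreeOff x I J → IsMinimalOutside q (set I) → IsMinimalOutside q (set J)
    go {I} {J} agree min =
      let q∉I , lower = Equivalence.to (isMinimalOutside⇔ I) min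
          x≢q , x⋖̸q , _ = far
      in Equivalence.from (isMinimalOutside⇔ J)
        ( (λ q∈J → q∉I (Equivalence.from (agree q (x≢q ∘ sym)) q∈J))
        , λ r r⋖q → Equivalence.to (agree r λ { refl → x⋖̸q r⋖q }) (lower r r⋖q))

  isMaximalIn-local : ∀ {x q I J} → Far x q → AgreeOff x I J →
    IsMaximalIn q (set I) ⇔ IsMaximalIn q (set J)
  isMaximalIn-local {x} {q} {I} {J} far agree =
    mk⇔ (go {I} {J} agree) (go {J} {I} (agreeOff-sym {x} {I} {J} agree))
    where
    go : ∀ {I J} → AgreeOff x I J → IsMaximalIn q (set I) → IsMaximalIn q (set J)
    go {I} {J} agree max =
      let q∈I , upper = Equivalence.to (isMaximalIn⇔ I) max
          x≢q , _ , q⋖̸x = far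
      in Equivalence.from (isMaximalIn⇔ J)
        ( Equivalence.to (agree q (x≢q ∘ sym)) q∈I
        , λ r q⋖r r∈J → upper r q⋖r (Equivalence.from (agree r λ { refl → q⋖̸x q⋖r }) r∈J))

  -- For incomparable `x` and `y` the four probes realise every combination of membership of `x` and
  -- `y` and agree elsewhere; they are the corners of the mixed difference.
  probe : Fin n → Fin n → Bool → Bool → OrderIdeal
  probe x y b c = cut x b ⊓ cut y c

  probe-agreeˡ : ∀ x y c → AgreeOff x (probe x y true c) (probe x y false c)
  probe-agreeˡ x y c = agreeOff-⊓ {x} {cut x true} {cut x false} {cut y c} {cut y c} (cut-agree x true false)
    (agreeOff-refl {x} {cut y c})

  probe-agreeʳ : ∀ x y b → AgreeOff y (probe x y b true) (probe x y b false)
  probe-agreeʳ x y b = agreeOff-⊓ {y} {cut x b} {cut x b} {cut y true} {cut y false}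
    (agreeOff-refl {y} {cut x b}) (cut-agree y true false)

  module Probe {r x y} (r≡1+x : pos r ≡ suc (pos x)) (y≡1+r : pos y ≡ suc (pos r)) where

    x<r : pos x < pos r
    x<r = ℕₚ.≤-reflexive (sym r≡1+x)

    r<y : pos r < pos y
    r<y = ℕₚ.≤-reflexive (sym y≡1+r)

    x≢y : x ≢ y
    x≢y refl = ℕₚ.<-irrefl refl (ℕₚ.<-trans x<r r<y)

    x≢r : x ≢ r
    x≢r refl = ℕₚ.<-irrefl refl x<r

    y≢r : y ≢ r
    y≢r refl = ℕₚ.<-irrefl refl r<y

    adjacent⇒≡ : ∀ {p} → pos p ≡ suc (pos r) ⊎ pos r ≡ suc (pos p) → p ≡ x ⊎ p ≡ y
    adjacent⇒≡ (inj₁ eq) = inj₂ (pos-injective (trans eq (sym y≡1+r)))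
    adjacent⇒≡ (inj₂ eq) = inj₁ (pos-injective (ℕₚ.suc-injective (trans (sym eq) r≡1+x)))

    apart⇒far : ∀ {p q} → suc (pos q) < pos p ⊎ suc (pos p) < pos q → Far p q
    apart⇒far {p} {q} apart = (λ { refl → same apart }) , (adjacent apart ∘ ⋖⇒adjacent) ,
      (adjacent apart ∘ swap ∘ ⋖⇒adjacent)
      where
      same : ∀ {k} → suc k < k ⊎ suc k < k → ⊥
      same (inj₁ lt) = ℕₚ.<-asym lt ℕₚ.≤-refl
      same (inj₂ lt) = ℕₚ.<-asym lt ℕₚ.≤-refl
      adjacent : suc (pos q) < pos p ⊎ suc (pos p) < pos q → ¬ (pos p ≡ suc (pos q) ⊎ pos q ≡ suc (pos p))
      adjacent (inj₁ lt) (inj₁ eq) = ℕₚ.<-irrefl (sym eq) lt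
      adjacent (inj₁ lt) (inj₂ eq) = ℕₚ.<-asym (ℕₚ.<⇒≤ lt) (ℕₚ.≤-reflexive (sym eq))
      adjacent (inj₂ lt) (inj₁ eq) = ℕₚ.<-asym (ℕₚ.<⇒≤ lt) (ℕₚ.≤-reflexive (sym eq))
      adjacent (inj₂ lt) (inj₂ eq) = ℕₚ.<-irrefl (sym eq) lt

    -- An element to the left of `r` is at least two positions away from `y`, one to the right at
    -- least two away from `x`. This is what isolates `T r` among all toggles.
    far-from-one : ∀ {q} → q ≢ r → Far x q ⊎ Far y q
    far-from-one {q} q≢r with ℕₚ.<-cmp (pos q) (pos r)
    ... | tri≈ _ q≡r _ = contradiction (pos-injective q≡r) q≢r
    ... | tri< q<r _ _ = inj₂ (apart⇒far (inj₁ (ℕₚ.≤-<-trans q<r r<y)))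
    ... | tri> _ _ r<q = inj₁ (apart⇒far (inj₂ (ℕₚ.≤-<-trans x<r r<q)))

    module Incomparable (x⋠y : ¬ (x ≼ y)) (y⋠x : ¬ (y ≼ x)) where

      x∈probe⇔ : ∀ {b c} → x ∈ set (probe x y b c) ⇔ (b ≡ true)
      x∈probe⇔ {b} {c} = mk⇔
        (λ x∈ → Equivalence.to x∈cut⇔ (proj₁ (x∈p∩q⁻ (set (cut x b)) (set (cut y c)) x∈)))
        (λ b → x∈p∩q⁺ (Equivalence.from x∈cut⇔ b , ⋠⇒∈cut y⋠x))

      y∈probe⇔ : ∀ {b c} → y ∈ set (probe x y b c) ⇔ (c ≡ true)
      y∈probe⇔ {b} {c} = mk⇔
        (λ y∈ → Equivalence.to x∈cut⇔ (proj₂ (x∈p∩q⁻ (set (cut x b)) (set (cut y c)) y∈)))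
        (λ c → x∈p∩q⁺ (⋠⇒∈cut x⋠y , Equivalence.from x∈cut⇔ c))

    module Peak (x⋖r : x ⋖ r) (y⋖r : y ⋖ r) where

      -- Otherwise `y` would lie strictly between `x` and `r`, although `r` covers `x`.
      x⋠y : ¬ (x ≼ y)
      x⋠y x≼y = case proj₂ (proj₂ (Equivalence.to ⋖⇔covers x⋖r)) y x≼y (y⋖r ◅ ε) of λ where
        (inj₁ y≡x) → x≢y (sym y≡x)
        (inj₂ y≡r) → y≢r y≡r

      y⋠x : ¬ (y ≼ x)
      y⋠x y≼x = case proj₂ (proj₂ (Equivalence.to ⋖⇔covers y⋖r)) x y≼x (x⋖r ◅ ε) of λ where
        (inj₁ x≡y) → x≢y x≡y
        (inj₂ x≡r) → x≢r x≡r

      open Incomparable x⋠y y⋠x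

      r∉probe : ∀ b c → r ∉ set (probe x y b c)
      r∉probe b c r∈ = ≺⇒∉cut (x⋖r ◅ ε) (x≢r ∘ sym) (proj₁ (x∈p∩q⁻ (set (cut x b)) (set (cut y c)) r∈))

      minimalOutside-probe : ∀ b c → does (isMinimalOutside? r (set (probe x y b c))) ≡ b ∧ c
      minimalOutside-probe b c = does≡ (isMinimalOutside? r (set (probe x y b c)))
        (∧-⇔ x∈probe⇔ y∈probe⇔ ⇔-∘ (both ⇔-∘ isMinimalOutside⇔ (probe x y b c)))
        where
        both : (r ∉ set (probe x y b c) × (∀ p → p ⋖ r → p ∈ set (probe x y b c))) ⇔
          (x ∈ set (probe x y b c) × y ∈ set (probe x y b c))
        both = mk⇔ (λ (_ , h) → h x x⋖r , h y y⋖r) λ (x∈ , y∈) → r∉probe b c , λ p p⋖r →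
          case adjacent⇒≡ (⋖⇒adjacent p⋖r) of λ where
            (inj₁ refl) → x∈
            (inj₂ refl) → y∈

      maximalIn-probe : ∀ b c → does (isMaximalIn? r (set (probe x y b c))) ≡ false
      maximalIn-probe b c = dec-false (isMaximalIn? r (set (probe x y b c))) (r∉probe b c ∘ proj₁)

    module Valley (r⋖x : r ⋖ x) (r⋖y : r ⋖ y) where

      x⋠y : ¬ (x ≼ y)
      x⋠y x≼y = case proj₂ (proj₂ (Equivalence.to ⋖⇔covers r⋖y)) x (r⋖x ◅ ε) x≼y of λ where
        (inj₁ x≡r) → x≢r x≡r
        (inj₂ x≡y) → x≢y x≡y

      y⋠x : ¬ (y ≼ x)
      y⋠x y≼x = case proj₂ (proj₂ (Equivalence.to ⋖⇔covers r⋖x)) y (r⋖y ◅ ε) y≼x of λ where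
        (inj₁ y≡r) → y≢r y≡r
        (inj₂ y≡x) → x≢y (sym y≡x)

      open Incomparable x⋠y y⋠x

      r∈probe : ∀ b c → r ∈ set (probe x y b c)
      r∈probe b c = x∈p∩q⁺
        ( ⋠⇒∈cut (λ x≼r → x≢r (≼-antisym x≼r (r⋖x ◅ ε)))
        , ⋠⇒∈cut (λ y≼r → y≢r (≼-antisym y≼r (r⋖y ◅ ε))))

      minimalOutside-probe : ∀ b c → does (isMinimalOutside? r (set (probe x y b c))) ≡ false
      minimalOutside-probe b c =
        dec-false (isMinimalOutside? r (set (probe x y b c))) λ (r∉ , _) → r∉ (r∈probe b c)

      maximalIn-probe : ∀ b c → does (isMaximalIn? r (set (probe x y b c))) ≡ not b ∧ not c
      maximalIn-probe b c = does≡ (isMaximalIn? r (set (probe x y b c)))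
        (∧-⇔ (¬⇔ x∈probe⇔) (¬⇔ y∈probe⇔) ⇔-∘ (both ⇔-∘ isMaximalIn⇔ (probe x y b c)))
        where
        ¬⇔ : ∀ {A : Set} {b} → A ⇔ (b ≡ true) → (¬ A) ⇔ (not b ≡ true)
        ¬⇔ {b = true}  A⇔ = mk⇔ (λ ¬A → contradiction (Equivalence.from A⇔ refl) ¬A) λ ()
        ¬⇔ {b = false} A⇔ = mk⇔ (λ _ → refl) λ _ A → contradiction (Equivalence.to A⇔ A) λ ()
        both : (r ∈ set (probe x y b c) × (∀ p → r ⋖ p → p ∉ set (probe x y b c))) ⇔
          (x ∉ set (probe x y b c) × y ∉ set (probe x y b c))
        both = mk⇔ (λ (_ , h) → h x r⋖x , h y r⋖y) λ (x∉ , y∉) → r∈probe b c , λ p r⋖p →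
          case adjacent⇒≡ (swap (⋖⇒adjacent r⋖p)) of λ where
            (inj₁ refl) → x∉
            (inj₂ refl) → y∉

-- Indexing a concatenated list by pairs.

module Enumeration {m : ℕ} (β : Fin m → ℕ) where

  row : ∀ i → List (∃ λ i → Fin (β i))
  row i = tabulate (i ,_)

  pairs : List (∃ λ i → Fin (β i))
  pairs = concat (tabulate row)

  pairs-unique : Unique pairs
  pairs-unique = Uniqueₚ.concat⁺ {xss = tabulate row}
    (Allₚ.tabulate⁺ {f = row} λ i → Uniqueₚ.tabulate⁺ {f = i ,_} λ { ≡.refl → ≡.refl })
    (AllPairsₚ.tabulate⁺ {f = row} λ {i} {i′} i≢i′ (x∈ , x∈′) →
      i≢i′ (≡.trans (≡.sym (∈-row i x∈)) (∈-row i′ x∈′)))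
    where
    ∈-row : ∀ i {x} → x ∈ᴸ row i → proj₁ x ≡ i
    ∈-row i x∈ = ≡.cong proj₁ (proj₂ (∈-tabulate⁻ {f = i ,_} x∈))

  ∈-pairs : ∀ i j → (i , j) ∈ᴸ pairs
  ∈-pairs i j = ∈-concat⁺′ (∈-tabulate⁺ {f = i ,_} j) (∈-tabulate⁺ {f = row} i)

  lookup-injective : ∀ {A : Set} {xs : List A} → Unique xs → ∀ k l → lookup xs k ≡ lookup xs l → k ≡ l
  lookup-injective (_ ∷ _) zero    zero    _  = ≡.refl
  lookup-injective (x∉ ∷ _) zero    (suc l) eq = contradiction eq (All.lookup x∉ (∈-lookup l))
  lookup-injective (x∉ ∷ _) (suc k) zero    eq = contradiction (≡.sym eq) (All.lookup x∉ (∈-lookup k))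
  lookup-injective (_ ∷ u) (suc k) (suc l) eq = ≡.cong suc (lookup-injective u k l eq)

  lookup-map : ∀ {A B : Set} (f : A → B) xs .(eq : length (map f xs) ≡ length xs) k →
    lookup (map f xs) k ≡ f (lookup xs (cast eq k))
  lookup-map f (x ∷ xs) eq zero    = ≡.refl
  lookup-map f (x ∷ xs) eq (suc k) = lookup-map f xs (ℕₚ.suc-injective eq) k

  module _ {A : Set} (g : ∀ i → Fin (β i) → A) where

    list : List A
    list = concat (tabulate λ i → tabulate λ j → g i j)

    -- Reduces distinctness and completeness of the list to those of the index pairs, which unlike
    -- functions on ideals are compared by propositional equality.
    list≡map : list ≡ map (uncurry g) pairs
    list≡map = ≡.trans
      (≡.cong concat (≡.sym (≡.trans (Listₚ.map-tabulate row (map (uncurry g)))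
        (Listₚ.tabulate-cong λ i → Listₚ.map-tabulate (i ,_) (uncurry g)))))
      (Listₚ.concat-map (tabulate row))

    length≡ : length list ≡ length pairs
    length≡ = ≡.trans (≡.cong length list≡map) (Listₚ.length-map (uncurry g) pairs)

    code : Fin (length list) → ∃ λ i → Fin (β i)
    code k = lookup pairs (cast length≡ k)

    lookup-list : ∀ k → lookup list k ≡ uncurry g (code k)
    -- Generalising the list to `L` makes its equation matchable by `refl`.
    lookup-list = go list≡map length≡
      where
      go : ∀ {L} → L ≡ map (uncurry g) pairs → .(eq : length L ≡ length pairs) → ∀ k →
        lookup L k ≡ uncurry g (lookup pairs (cast eq k))
      go ≡.refl eq = lookup-map (uncurry g) pairs eq

    code-injective : ∀ {k l} → code k ≡ code l → k ≡ l
    code-injective {k} {l} eq = toℕ-injective (≡.trans (≡.sym (toℕ-cast length≡ k))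
      (≡.trans (≡.cong toℕ (lookup-injective pairs-unique _ _ eq)) (toℕ-cast length≡ l)))

    code-surjective : ∀ i j → ∃ λ k → code k ≡ (i , j)
    code-surjective i j = cast (≡.sym length≡) k , ≡.trans
      (≡.cong (lookup pairs) (toℕ-injective (≡.trans (toℕ-cast length≡ _) (toℕ-cast (≡.sym length≡) k))))
      (≡.sym (Anyₚ.lookup-index (∈-pairs i j)))
      where
      k : Fin (length pairs)
      k = Any.index (∈-pairs i j)

-- The arbitrary `g` lets the induction pass to the tail of `ms`; `basisElement`, tied to all of
-- `α`, would not restrict to it.
length-concat-tabulate : ∀ {A : Set} (f : ℕ → ℕ) ms (g : ∀ i → Fin (f (lookup ms i)) → A) →
  length (concat (tabulate λ i → tabulate (g i))) ≡ sum (map f ms)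
length-concat-tabulate f []       g = ≡.refl
length-concat-tabulate f (m ∷ ms) g = ≡.trans (Listₚ.length-++ (tabulate (g zero)))
  (≡.cong₂ ℕ._+_ (Listₚ.length-tabulate (g zero)) (length-concat-tabulate f ms (λ i → g (suc i))))

-- Multiples of one are constant sequences. The rational `q m` follows the recursion of `ι m`, so
-- its reciprocal, as a constant sequence, is the inverse.
ℝ-positivesInvertible : NaturalMultiples.PositivesInvertible ℝ-commutativeRing
ℝ-positivesInvertible (suc m) _ =
  Reals.fromℚ (ℚ.1/ q (suc m)) ,
  Reals.pointwise (Reals.fromℚ (ℚ.1/ q (suc m)) Reals.*ᴿ ι (suc m)) (Reals.fromℚ 1ℚ)
    λ k → ≡.trans (≡.cong (ℚ.1/ q (suc m) ℚ.*_) (seq-ι (suc m) k)) (ℚₚ.*-inverseˡ (q (suc m)))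
  where
  open NaturalMultiples ℝ-commutativeRing using (ι)
  q : ℕ → ℚ
  q zero    = 0ℚ
  q (suc m) = 1ℚ ℚ.+ q m
  q-nonNegative : ∀ m → ℚ.NonNegative (q m)
  q-nonNegative zero    = _
  q-nonNegative (suc m) = ℚₚ.nonNeg+nonNeg⇒nonNeg 1ℚ (q m) {{q-nonNegative m}}
  instance
    q-nonZero : ℚ.NonZero (q (suc m))
    q-nonZero = ℚₚ.pos⇒nonZero (q (suc m)) {{ℚₚ.pos+nonNeg⇒pos 1ℚ (q m) {{q-nonNegative m}}}}
  seq-ι : ∀ m k → Reals.seq (ι m) k ≡ q m
  seq-ι zero    k = ≡.refl
  seq-ι (suc m) k = ≡.cong (1ℚ ℚ.+_) (seq-ι m k)

-- Extended indicators and toggles along a segment.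

module FenceBasis (R : CommutativeRing 0ℓ 0ℓ)
  (positives-invertible : NaturalMultiples.PositivesInvertible R)
  (α : List ℕ) (shape : IsFenceShape α) where

  open CommutativeRing R hiding (zero)
  open IntegerSolver R
  open NaturalMultiples R
  open FiniteSums R
  open SetoidReasoning setoid
  open SemiringMult semiring using () renaming (_×_ to _·_)
  open Fence α
  open FenceStructure α shape
  open FenceFunctions R α
  open FunctionSpace R {OrderIdeal}
  open Linear R {OrderIdeal}

  𝟙 : Bool → Carrier
  𝟙 b = if b then 1# else 0#

  X : ℕ → OrderIdeal → Carrier
  X k I = 𝟙 (member I k)

  X-pos : ∀ {q k} → pos q ≡ k → X k ≋ χ̂ q
  X-pos q≡k I = reflexive (≡.cong 𝟙 (member-pos I q≡k))

  -- `d`, `v`, `u` are the memberships of three consecutive chain elements, from below. An ideal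
  -- meets the chain in an initial part, which leaves four of the eight patterns to check.
  toggle-value : ∀ v d u → (v ≡ true → d ≡ true) → (v ≡ false → u ≡ false) →
    (if not v ∧ d then 1# else if v ∧ not u then - 1# else 0#) ≈ (𝟙 d + 𝟙 u) - (𝟙 v + 𝟙 v)
  toggle-value true  false _     d∋ _  = contradiction (d∋ ≡.refl) λ ()
  toggle-value false _     true  _  ∌u = contradiction (∌u ≡.refl) λ ()
  toggle-value true  true  true  _  _  =
    solve 0 (con (+ 0) := (con (+ 1) :+ con (+ 1)) :- (con (+ 1) :+ con (+ 1))) refl
  toggle-value true  true  false _  _  =
    solve 0 (:- con (+ 1) := (con (+ 1) :+ con (+ 0)) :- (con (+ 1) :+ con (+ 1))) refl
  toggle-value false true  false _  _  =
    solve 0 (con (+ 1) := (con (+ 1) :+ con (+ 0)) :- (con (+ 0) :+ con (+ 0))) refl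
  toggle-value false false false _  _  =
    solve 0 (con (+ 0) := (con (+ 0) :+ con (+ 0)) :- (con (+ 0) :+ con (+ 0))) refl

  T-straight : ∀ {q d u} → Straight q d u → T q ≋ λ I → (X d I + X u I) - (χ̂ q I + χ̂ q I)
  T-straight {q} {d} {u} straight I
    rewrite minimalOutside≡ straight I | maximalIn≡ straight I =
    toggle-value (does (q ∈? set I)) (member I d) (member I u)
      (member-below straight I) (member-above straight I)

  module Segment (i : Fin t) where

    w lo : ℕ
    w  = lookup α i
    lo = a (toℕ i)

    open SecondDifferences (λ j → X (j ℕ.+ lo)) w public

    hi≡ : a (suc (toℕ i)) ≡ w ℕ.+ lo
    hi≡ = ≡.trans (a-suc i) (ℕₚ.+-comm lo w)

    inside : ∀ {j} → suc j < w → Inside i (suc j ℕ.+ lo)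
    inside {j} 1+j<w = s≤s (ℕₚ.m≤n+m lo j) , subst (suc j ℕ.+ lo <_) (≡.sym hi≡) (ℕₚ.+-monoˡ-< lo 1+j<w)

    T≋second : ∀ {q j} → suc j < w → pos q ≡ suc j ℕ.+ lo → T q ≋ second j
    T≋second {q} {j} 1+j<w q≡ I = go (parity (suc (toℕ i))) ≡.refl
      where
      χ̂-X : - (χ̂ q I + χ̂ q I) ≈ - (X (suc j ℕ.+ lo) I + X (suc j ℕ.+ lo) I)
      χ̂-X = -‿cong (sym (+-cong (X-pos q≡ I) (X-pos q≡ I)))
      go : ∀ π → parity (suc (toℕ i)) ≡ π → T q I ≈ second j I
      go 1ℙ odd  = let c , d = inside-steps {Odd} {i} (inside 1+j<w) odd in
        trans (T-straight (straight-up q≡ c d) I) (+-congˡ χ̂-X)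
      -- In a descending segment the lower neighbour has the larger index; the second difference is
      -- symmetric, so only the order of a sum changes.
      go 0ℙ even = let c , d = inside-steps {Even} {i} (inside 1+j<w) even in
        trans (T-straight (straight-down q≡ c d) I) (+-cong (+-comm _ _) χ̂-X)

  -- A missing peak or valley contributes zero, whereas the extended indicator there is a constant:
  -- 1 at position 0, and decided by the parity of `t` at `n + 1`.
  endpoint-X : ∀ {e x} → Endpoint e x → ∃ λ c → X (a e) ≋ λ I → χ̂? x I + c
  endpoint-X (present _ x≡)         = 0# , λ I → trans (X-pos x≡ I) (sym (+-identityʳ _))
  endpoint-X (absent (inj₁ ≡.refl)) = 1# , λ I → sym (+-identityˡ 1#)
  endpoint-X (absent (inj₂ ≡.refl)) = 𝟙 (does (even? t)) , λ I →
    trans (reflexive (≡.cong 𝟙 (member-top I (ℕₚ.≤-reflexive 1+n≡a-t)))) (sym (+-identityˡ _))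

  module _ (i : Fin t) where

    open Segment i

    peakEnd valleyEnd : Parity → ℕ
    peakEnd   1ℙ = suc (toℕ i)
    peakEnd   0ℙ = toℕ i
    valleyEnd 1ℙ = toℕ i
    valleyEnd 0ℙ = suc (toℕ i)

    parity-i : ∀ {π} → parity (suc (toℕ i)) ≡ π → parity (toℕ i) ≡ π ⁻¹
    parity-i eq = ≡.trans (≡.sym (Parityₚ.suc-homo-⁻¹ (toℕ i))) (≡.cong _⁻¹ eq)

    peak-endpoint : ∀ π → parity (suc (toℕ i)) ≡ π → Endpoint (peakEnd π) (peak i)
    peak-endpoint 1ℙ eq = endpoint-at 1ℙ i (inj₂ ≡.refl) eq
    peak-endpoint 0ℙ eq = endpoint-at 1ℙ i (inj₁ ≡.refl) (parity-i eq)

    valley-endpoint : ∀ π → parity (suc (toℕ i)) ≡ π → Endpoint (valleyEnd π) (valley i)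
    valley-endpoint 1ℙ eq = endpoint-at 0ℙ i (inj₁ ≡.refl) (parity-i eq)
    valley-endpoint 0ℙ eq = endpoint-at 0ℙ i (inj₂ ≡.refl) eq

    ι-split : ∀ {k} → k ≤ w → ι w ≈ ι k + ι (w ∸ k)
    ι-split {k} k≤w = trans (reflexive (≡.cong ι (≡.sym (ℕₚ.m+[n∸m]≡n k≤w)))) (ι-+ k (w ∸ k))

    -- The height of s i j above the low-index end of its segment.
    height : Parity → Fin (β i) → ℕ
    height 1ℙ j = suc (toℕ j)
    height 0ℙ j = w ∸ suc (toℕ j)

    pos-s : ∀ π → parity (suc (toℕ i)) ≡ π → ∀ j → pos (s i j) ≡ height π j ℕ.+ lo
    pos-s 1ℙ eq j = ≡.trans (pos-s-odd i j eq) (ℕₚ.+-comm lo _)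
    pos-s 0ℙ eq j = ≡.trans (pos-s-even i j eq) (ℕₚ.+-comm lo _)

    -- In an ascending segment the peak is the high-index end. In a descending one the two ends
    -- trade places, and so do `suc (toℕ j)` and `w ∸ suc (toℕ j)`, which `height` accounts for.
    basisElement≋line : ∀ π → parity (suc (toℕ i)) ≡ π → ∀ j →
      ∃ λ c → basisElement i j ≋ λ I → line (height π j) I + c
    -- The constant collects the offsets of the two ends, weighted by the coefficients of peak and
    -- valley.
    basisElement≋line π eq j = J * cₚ + M * cᵥ , λ I → trans
      (+-cong (+-cong (·≈ι* w _) (-‿cong (·≈ι* (suc (toℕ j)) _))) (-‿cong (·≈ι* (w ∸ suc (toℕ j)) _)))
      (go π eq I (Xₚ I) (Xᵥ I))
      where
      J M : Carrier
      J = ι (suc (toℕ j))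
      M = ι (w ∸ suc (toℕ j))
      W≈ : ι w ≈ J + M
      W≈ = ι-split (ℕₚ.<⇒≤ (1+j<α i j))
      cₚ cᵥ : Carrier
      cₚ = proj₁ (endpoint-X (peak-endpoint π eq))
      cᵥ = proj₁ (endpoint-X (valley-endpoint π eq))
      Xₚ : X (a (peakEnd π)) ≋ λ I → χ̂? (peak i) I + cₚ
      Xₚ = proj₂ (endpoint-X (peak-endpoint π eq))
      Xᵥ : X (a (valleyEnd π)) ≋ λ I → χ̂? (valley i) I + cᵥ
      Xᵥ = proj₂ (endpoint-X (valley-endpoint π eq))
      go : ∀ π → parity (suc (toℕ i)) ≡ π → ∀ I →
        X (a (peakEnd π)) I ≈ χ̂? (peak i) I + cₚ →
        X (a (valleyEnd π)) I ≈ χ̂? (valley i) I + cᵥ →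
        (ι w * χ̂ (s i j) I - J * χ̂? (peak i) I) - M * χ̂? (valley i) I
          ≈ line (height π j) I + (J * cₚ + M * cᵥ)
      go 1ℙ eq I Xₚ Xᵥ = trans (+-congʳ (+-congʳ (*-congʳ W≈))) (trans
        (solve 7 (λ A p v cₚ cᵥ J M →
            ((J :+ M) :* A :- J :* p) :- M :* v
            := (((J :+ M) :* A :- J :* (p :+ cₚ)) :- ((J :+ M) :- J) :* (v :+ cᵥ)) :+ (J :* cₚ :+ M :* cᵥ))
          refl (χ̂ (s i j) I) (χ̂? (peak i) I) (χ̂? (valley i) I) cₚ cᵥ J M)
        (+-congʳ (sym (line-cong {suc (toℕ j)} W≈ (X-pos (pos-s 1ℙ eq j) I)
          (trans (reflexive (≡.cong (λ k → X k I) (≡.sym hi≡))) Xₚ) Xᵥ))))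
      go 0ℙ eq I Xₚ Xᵥ = trans (+-congʳ (+-congʳ (*-congʳ W≈))) (trans
        (solve 7 (λ A p v cₚ cᵥ J M →
            ((J :+ M) :* A :- J :* p) :- M :* v
            := (((J :+ M) :* A :- M :* (v :+ cᵥ)) :- ((J :+ M) :- M) :* (p :+ cₚ)) :+ (J :* cₚ :+ M :* cᵥ))
          refl (χ̂ (s i j) I) (χ̂? (peak i) I) (χ̂? (valley i) I) cₚ cᵥ J M)
        (+-congʳ (sym (line-cong {w ∸ suc (toℕ j)} W≈ (X-pos (pos-s 0ℙ eq j) I)
          (trans (reflexive (≡.cong (λ k → X k I) (≡.sym hi≡))) Xᵥ) Xₚ))))

    1+index : ∀ {h} → 0 < h → h < w → ∃ λ (j : Fin (β i)) → suc (toℕ j) ≡ h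
    1+index {suc h} _ h<w = fromℕ< (ℕₚ.∸-monoˡ-≤ 1 h<w) , ≡.cong suc (toℕ-fromℕ< _)

    height-surjective : ∀ π {h} → 0 < h → h < w → ∃ λ j → height π j ≡ h
    height-surjective 1ℙ 0<h h<w = 1+index 0<h h<w
    height-surjective 0ℙ 0<h h<w
      with 1+index (ℕₚ.m<n⇒0<n∸m h<w) (ℕₚ.∸-monoʳ-< 0<h (ℕₚ.<⇒≤ h<w))
    ... | j , eq = j , ≡.trans (≡.cong (w ∸_) eq) (ℕₚ.m∸[m∸n]≡n (ℕₚ.<⇒≤ h<w))

    height-≤ : ∀ π j → height π j ≤ w
    height-≤ 1ℙ j = ℕₚ.<⇒≤ (1+j<α i j)
    height-≤ 0ℙ j = ℕₚ.m∸n≤m w (suc (toℕ j))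

    basisElement∈Const+Span-T : ∀ j → basisElement i j ∈Const+Span T
    basisElement∈Const+Span-T j =
      let c , eq = basisElement≋line (parity (suc (toℕ i))) ≡.refl j
      in resp (λ I → sym (eq I)) (+∈
        (second⇒line (Const+Span-isSubspace T) second∈ _ (height-≤ (parity (suc (toℕ i))) j))
        (const∈Const+Span T c))
      where
      open IsSubspace (Const+Span-isSubspace T)
      second∈ : ∀ j → suc j < w → second j ∈Const+Span T
      second∈ j 1+j<w = resp (T≋second 1+j<w q≡) (Span⊆Const+Span (member∈Span T q))
        where
        q : Fin n
        q = fromInside i (suc j ℕ.+ lo) (inside 1+j<w)
        q≡ : pos q ≡ suc j ℕ.+ lo
        q≡ = pos-fromPos (suc j ℕ.+ lo) (ℕₚ.≤-<-trans z≤n (proj₁ (inside 1+j<w)))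
          (ℕₚ.<-≤-trans (proj₂ (inside 1+j<w)) (a≤sum i))

    -- Modulo constants the basis elements are the `line` functions at all inner heights, and these
    -- recover the second differences after division by `w`. The family `b` is arbitrary so that it
    -- can later be the flattened list.
    T∈Const+Span : ∀ {m} (b : Fin m → OrderIdeal → Carrier) →
      (∀ j → basisElement i j ∈Const+Span b) → ∀ {q} → Inside i (pos q) → T q ∈Const+Span b
    T∈Const+Span b basis∈ {q} (lo<q , q<hi) with pos q ∸ lo in eq | ℕₚ.m<n⇒0<n∸m lo<q
    ... | suc j | _ = resp (λ I → sym (T≋second 1+j<w q≡ I))
      (line⇒second (Const+Span-isSubspace b) (positives-invertible w (IsFenceShape.positive shape i))
        line∈ j 1+j<w)
      where
      open IsSubspace (Const+Span-isSubspace b)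
      q≡ : pos q ≡ suc j ℕ.+ lo
      q≡ = ≡.trans (≡.sym (ℕₚ.m∸n+n≡m (ℕₚ.<⇒≤ lo<q))) (≡.cong (ℕ._+ lo) eq)
      1+j<w : suc j < w
      1+j<w = ℕₚ.+-cancelʳ-< lo _ _ (≡.subst₂ _<_ q≡ hi≡ q<hi)
      π : Parity
      π = parity (suc (toℕ i))
      line∈ : ∀ h → 0 < h → h < w → line h ∈Const+Span b
      line∈ h 0<h h<w with height-surjective π 0<h h<w
      ... | j , ≡.refl =
        let c , eq = basisElement≋line π ≡.refl j
        in resp (λ I → trans (+-congʳ (eq I))
             (solve 2 (λ x c → (x :+ c) :+ (:- c) := x) refl (line (height π j) I) c))
           (+∈ (basis∈ j) (const∈Const+Span b (- c)))

  -- Membership of the basis elements in `I_T`.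

  χ̂?∈Span : ∀ x → χ̂? x ∈Span χ̂
  χ̂?∈Span nothing  = IsSubspace.0∈ (Span-isSubspace χ̂)
  χ̂?∈Span (just q) = member∈Span χ̂ q

  basisElement∈Span-χ̂ : ∀ i j → basisElement i j ∈Span χ̂
  basisElement∈Span-χ̂ i j =
    +∈ (+∈ (·∈ (lookup α i) (member∈Span χ̂ (s i j)))
           (neg∈ (·∈ (suc (toℕ j)) (χ̂?∈Span (peak i)))))
       (neg∈ (·∈ (lookup α i ∸ suc (toℕ j)) (χ̂?∈Span (valley i))))
    where
    open IsSubspace (Span-isSubspace χ̂)

  basisElement∈I_T : ∀ i j → I_T (basisElement i j)
  basisElement∈I_T i j = basisElement∈Span-χ̂ i j , basisElement∈Const+Span-T i j

  -- Difference functionals on functions of ideals.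

  χ̂-local : ∀ {x q I J} → q ≢ x → AgreeOff x I J → χ̂ q I ≡ χ̂ q J
  χ̂-local {q = q} {I} {J} q≢x agree =
    ≡.cong 𝟙 (does-⇔ (agree q q≢x) (q ∈? set I) (q ∈? set J))

  T-local : ∀ {x q I J} → Far x q → AgreeOff x I J → T q I ≡ T q J
  T-local {x} {q} {I} {J} far agree = ≡.cong₂ (λ b c → if b then 1# else if c then - 1# else 0#)
    (does-⇔ (isMinimalOutside-local {x} {q} {I} {J} far agree)
      (isMinimalOutside? q (set I)) (isMinimalOutside? q (set J)))
    (does-⇔ (isMaximalIn-local {x} {q} {I} {J} far agree)
      (isMaximalIn? q (set I)) (isMaximalIn? q (set J)))

  -- The change caused by adding `q` to the largest ideal without it; these functionals are dual to
  -- the family `χ̂`.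
  jump : Fin n → (OrderIdeal → Carrier) → Carrier
  jump q f = f (cut q true) - f (cut q false)

  jump-isLinear : ∀ q → IsLinear (jump q)
  jump-isLinear q = difference-isLinear (eval-isLinear (cut q true)) (eval-isLinear (cut q false))

  χ̂?-cut : ∀ {e x q} → Endpoint e x → ¬ Shared q → χ̂? x (cut q true) ≡ χ̂? x (cut q false)
  χ̂?-cut {x = just p} {q} (present shared _) ¬shared =
    χ̂-local {q} {p} {I = cut q true} {cut q false} (λ { ≡.refl → ¬shared shared }) (cut-agree q true false)
  χ̂?-cut (absent _) _ = ≡.refl

  -- Peaks and valleys are shared, so their indicators do not notice an unshared `q` and cancel.
  jump-basisElement : ∀ q → ¬ Shared q → ∀ i j →
    jump q (basisElement i j) ≈ ι (lookup α i) * jump q (χ̂ (s i j))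
  jump-basisElement q ¬shared i j
    rewrite χ̂?-cut {q = q} (peak-endpoint i _ ≡.refl) ¬shared
          | χ̂?-cut {q = q} (valley-endpoint i _ ≡.refl) ¬shared = trans
    (solve 4 (λ A B p v → ((A :- p) :- v) :- ((B :- p) :- v) := A :- B) refl
      (w · χ̂ (s i j) (cut q true)) (w · χ̂ (s i j) (cut q false))
      (suc (toℕ j) · χ̂? (peak i) (cut q false)) ((w ∸ suc (toℕ j)) · χ̂? (valley i) (cut q false)))
    (trans (+-cong (·≈ι* w _) (-‿cong (·≈ι* w _)))
      (solve 3 (λ W A B → W :* A :- W :* B := W :* (A :- B)) refl
        (ι w) (χ̂ (s i j) (cut q true)) (χ̂ (s i j) (cut q false))))
    where
    w : ℕ
    w = lookup α i

  jump-χ̂-≢ : ∀ {q p} → p ≢ q → jump q (χ̂ p) ≈ 0#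
  jump-χ̂-≢ {q} {p} p≢q = trans
    (+-congʳ (reflexive (χ̂-local {I = cut q true} {cut q false} p≢q (cut-agree q true false)))) (-‿inverseʳ _)

  jump-χ̂-≡ : ∀ q → jump q (χ̂ q) ≈ 1#
  jump-χ̂-≡ q
    rewrite dec-true (q ∈? set (cut q true)) (Equivalence.from x∈cut⇔ ≡.refl)
          | dec-false (q ∈? set (cut q false)) (λ q∈ → contradiction (Equivalence.to x∈cut⇔ q∈) λ ()) =
    solve 0 (con (+ 1) :- con (+ 0) := con (+ 1)) refl

  T-congruent : ∀ {q I b c} → does (isMinimalOutside? q (set I)) ≡ b → does (isMaximalIn? q (set I)) ≡ c →
    T q I ≡ (if b then 1# else if c then - 1# else 0#)
  T-congruent = ≡.cong₂ λ b c → if b then 1# else if c then - 1# else 0#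

  module MixedDifference {r x y} (r≡1+x : pos r ≡ suc (pos x)) (y≡1+r : pos y ≡ suc (pos r)) where

    open Probe r≡1+x y≡1+r

    mixed : (OrderIdeal → Carrier) → Carrier
    mixed f = (f (probe x y true true)  - f (probe x y true false))
            - (f (probe x y false true) - f (probe x y false false))

    mixed-isLinear : IsLinear mixed
    mixed-isLinear = difference-isLinear
      (difference-isLinear (eval-isLinear _) (eval-isLinear _))
      (difference-isLinear (eval-isLinear _) (eval-isLinear _))

    open IsLinear mixed-isLinear

    mixed-ignoring-x : ∀ f → (∀ c → f (probe x y true c) ≡ f (probe x y false c)) → mixed f ≈ 0#
    mixed-ignoring-x f eq rewrite eq true | eq false = -‿inverseʳ _

    mixed-ignoring-y : ∀ f → (∀ b → f (probe x y b true) ≡ f (probe x y b false)) → mixed f ≈ 0#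
    mixed-ignoring-y f eq rewrite eq true | eq false =
      solve 2 (λ a b → (a :- a) :- (b :- b) := con (+ 0)) refl
        (f (probe x y true false)) (f (probe x y false false))

    mixed-const : ∀ c → mixed (λ _ → c) ≈ 0#
    mixed-const c = mixed-ignoring-x (λ _ → c) λ _ → ≡.refl

    -- A single indicator depends on at most one of `x` and `y`, so one of the two differences
    -- already kills it.
    mixed-χ̂ : ∀ q → mixed (χ̂ q) ≈ 0#
    mixed-χ̂ q with q ≟ᶠ x
    ... | no  q≢x = mixed-ignoring-x (χ̂ q) λ c →
      χ̂-local {x} {q} {probe x y true c} {probe x y false c} q≢x (probe-agreeˡ x y c)
    ... | yes ≡.refl = mixed-ignoring-y (χ̂ q) λ b →
      χ̂-local {y} {q} {probe x y b true} {probe x y b false} x≢y (probe-agreeʳ x y b)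

    mixed-T-≢ : ∀ q → q ≢ r → mixed (T q) ≈ 0#
    mixed-T-≢ q q≢r with far-from-one q≢r
    ... | inj₁ far = mixed-ignoring-x (T q) λ c →
      T-local {x} {q} {probe x y true c} {probe x y false c} far (probe-agreeˡ x y c)
    ... | inj₂ far = mixed-ignoring-y (T q) λ b →
      T-local {y} {q} {probe x y b true} {probe x y b false} far (probe-agreeʳ x y b)

    -- At a peak, `T r` is 1 only on the probe containing both `x` and `y`; at a valley it is -1
    -- only on the probe containing neither. Both corners enter with sign plus, so the value is 1 or
    -- -1 and is its own inverse.
    mixed-T-≡ : Neighbours r x y → ∃ λ u → u * mixed (T r) ≈ 1#
    mixed-T-≡ (peak-of x⋖r y⋖r) = 1# , trans
      (*-congˡ (+-cong (+-cong (T≈ true true) (-‿cong (T≈ true false)))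
        (-‿cong (+-cong (T≈ false true) (-‿cong (T≈ false false))))))
      (solve 0 (con (+ 1) :* ((con (+ 1) :- con (+ 0)) :- (con (+ 0) :- con (+ 0))) := con (+ 1)) refl)
      where
      open Peak x⋖r y⋖r
      T≈ : ∀ b c → T r (probe x y b c) ≈ (if b ∧ c then 1# else 0#)
      T≈ b c = reflexive (T-congruent {r} {probe x y b c} (minimalOutside-probe b c) (maximalIn-probe b c))
    mixed-T-≡ (valley-of r⋖x r⋖y) = - 1# , trans
      (*-congˡ (+-cong (+-cong (T≈ true true) (-‿cong (T≈ true false)))
        (-‿cong (+-cong (T≈ false true) (-‿cong (T≈ false false))))))
      (solve 0 ((:- con (+ 1)) :* ((con (+ 0) :- con (+ 0)) :- (con (+ 0) :- (:- con (+ 1)))) := con (+ 1)) refl)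
      where
      open Valley r⋖x r⋖y
      T≈ : ∀ b c → T r (probe x y b c) ≈ (if not b ∧ not c then - 1# else 0#)
      T≈ b c = reflexive (T-congruent {r} {probe x y b c} (minimalOutside-probe b c) (maximalIn-probe b c))

    coefficient-zero : Neighbours r x y → ∀ {f c d} → f ∈Span χ̂ → (f ≋ λ I → c + lincomb d T I) → d r ≈ 0#
    coefficient-zero neighbours {f} {c} {d} (e , f≋χ̂) f≋T =
      trans (sym (trans (*-congʳ uφ≈1) (*-identityˡ (d r))))
        (trans (solve 3 (λ u φ d → (u :* φ) :* d := u :* (d :* φ)) refl u (mixed (T r)) (d r))
          (trans (*-congˡ d*φ≈0) (zeroʳ u)))
      where
      u : Carrier
      u = proj₁ (mixed-T-≡ neighbours)
      uφ≈1 : u * mixed (T r) ≈ 1#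
      uφ≈1 = proj₂ (mixed-T-≡ neighbours)
      mixed-f≈0 : mixed f ≈ 0#
      mixed-f≈0 = trans (cong f≋χ̂) (trans (lincomb-homo e χ̂)
        (∑-zero _ λ k → trans (*-congˡ (mixed-χ̂ k)) (zeroʳ (e k))))
      mixed-f≈ : mixed f ≈ d r * mixed (T r)
      mixed-f≈ = trans (cong f≋T) (trans (+-homo (λ _ → c) (lincomb d T))
        (trans (+-cong (mixed-const c) (trans (lincomb-homo d T)
          (∑-only r _ λ k k≢r → trans (*-congˡ (mixed-T-≢ k k≢r)) (zeroʳ (d k))))) (+-identityˡ _)))
      d*φ≈0 : d r * mixed (T r) ≈ 0#
      d*φ≈0 = trans (sym mixed-f≈) mixed-f≈0

  shared-coefficient-zero : ∀ {f c d} → f ∈Span χ̂ → (f ≋ λ I → c + lincomb d T I) →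
    ∀ {r} → Shared r → d r ≈ 0#
  shared-coefficient-zero f∈ f≋T shared =
    let x , y , r≡1+x , y≡1+r , neighbours = shared-neighbours shared
    in MixedDifference.coefficient-zero r≡1+x y≡1+r neighbours f∈ f≋T

  -- Independence and spanning.

  χ̂-∅ : ∀ q → χ̂ q ∅ ≈ 0#
  χ̂-∅ q rewrite dec-false (q ∈? set ∅) ∉⊥ = refl

  -- Evaluation at the empty ideal detects the constant in an expansion modulo constants.
  Span-χ̂-∅ : ∀ {f} → f ∈Span χ̂ → f ∅ ≈ 0#
  Span-χ̂-∅ (e , f≋) = trans (f≋ ∅) (∑-zero _ λ k → trans (*-congˡ (χ̂-∅ k)) (zeroʳ (e k)))

  module Family {m} (b : Fin m → OrderIdeal → Carrier) (code : Fin m → ∃ λ i → Fin (β i))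
    (b≡ : ∀ k → b k ≡ uncurry basisElement (code k))
    (code-injective : ∀ {k l} → code k ≡ code l → k ≡ l)
    (code-surjective : ∀ i j → ∃ λ k → code k ≡ (i , j)) where

    b∈I_T : ∀ k → I_T (b k)
    b∈I_T k = subst I_T (≡.sym (b≡ k)) (uncurry basisElement∈I_T (code k))

    -- The jump at the unshared element of `b k` kills every other member, because `s` and `code`
    -- are injective, and takes the invertible value `ι w` on `b k` itself.
    b-independent : LinearlyIndependent b
    b-independent c cb≈0 k = trans (sym (trans (*-congʳ uw≈1) (*-identityˡ (c k))))
      (trans (solve 3 (λ u w c → (u :* w) :* c := u :* (c :* w)) refl u (ι w) (c k))
        (trans (*-congˡ cw≈0) (zeroʳ u)))
      where
      i : Fin t
      i = proj₁ (code k)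
      j : Fin (β i)
      j = proj₂ (code k)
      q : Fin n
      q = s i j
      w : ℕ
      w = lookup α i
      u : Carrier
      u = proj₁ (positives-invertible w (IsFenceShape.positive shape i))
      uw≈1 : u * ι w ≈ 1#
      uw≈1 = proj₂ (positives-invertible w (IsFenceShape.positive shape i))
      open IsLinear (jump-isLinear q)
      jump-b : ∀ l → jump q (b l) ≈
        ι (lookup α (proj₁ (code l))) * jump q (χ̂ (uncurry s (code l)))
      jump-b l = trans (reflexive (≡.cong (jump q) (b≡ l)))
        (jump-basisElement q (s-unshared i j) (proj₁ (code l)) (proj₂ (code l)))
      s-code-≢ : ∀ l → l ≢ k → uncurry s (code l) ≢ q
      s-code-≢ l l≢k eq = l≢k (code-injective (s-injective eq))
      cw≈0 : c k * ι w ≈ 0#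
      cw≈0 = begin
        c k * ι w                      ≈⟨ *-congˡ (*-identityʳ (ι w)) ⟨
        c k * (ι w * 1#)               ≈⟨ *-congˡ (*-congˡ (jump-χ̂-≡ q)) ⟨
        c k * (ι w * jump q (χ̂ q))     ≈⟨ *-congˡ (jump-b k) ⟨
        c k * jump q (b k)             ≈⟨ ∑-only k _ (λ l l≢k → trans
                                            (*-congˡ (trans (jump-b l) (trans
                                              (*-congˡ (jump-χ̂-≢ (s-code-≢ l l≢k))) (zeroʳ _))))
                                            (zeroʳ (c l))) ⟨
        (∑ λ l → c l * jump q (b l))   ≈⟨ lincomb-homo c b ⟨
        jump q (lincomb c b)           ≈⟨ cong cb≈0 ⟩
        jump q (λ _ → 0#)              ≈⟨ 0-homo ⟩
        0#                             ∎

    -- In the toggle expansion of `f` the shared terms vanish and the unshared ones lie in the span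
    -- of `b` modulo constants. The remaining constant `c′` is zero because `f` and all members of
    -- `b` vanish on `∅`.
    b-spans : ∀ f → I_T f → f ∈Span b
    b-spans f (f∈ , c , d , f≋) =
      let c′ , cs , f≋b = f∈Const+Span
          c′≈0 = begin
            c′                     ≈⟨ +-identityʳ c′ ⟨
            c′ + 0#                ≈⟨ +-congˡ (∑-zero _ λ k → trans
                                        (*-congˡ (Span-χ̂-∅ (proj₁ (b∈I_T k)))) (zeroʳ (cs k))) ⟨
            c′ + lincomb cs b ∅    ≈⟨ f≋b ∅ ⟨
            f ∅                    ≈⟨ Span-χ̂-∅ f∈ ⟩
            0#                     ∎
      in cs , λ I → trans (f≋b I) (trans (+-congʳ c′≈0) (+-identityˡ _))
      where
      open IsSubspace (Const+Span-isSubspace b)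
      basis∈ : ∀ i j → basisElement i j ∈Const+Span b
      basis∈ i j with code-surjective i j
      ... | k , eq = subst (_∈Const+Span b) (≡.trans (b≡ k) (≡.cong (uncurry basisElement) eq))
        (Span⊆Const+Span (member∈Span b k))
      term∈ : ∀ q → (λ I → d q * T q I) ∈Const+Span b
      term∈ q with shared? q
      ... | yes shared = resp (λ I → sym (trans (*-congʳ (shared-coefficient-zero f∈ f≋ shared)) (zeroˡ _))) 0∈
      ... | no ¬shared = let i , inside = unshared⇒inside ¬shared in
        *∈ (d q) (T∈Const+Span i b (basis∈ i) inside)
      f∈Const+Span : f ∈Const+Span b
      f∈Const+Span = resp (λ I → sym (f≋ I)) (+∈ (const∈Const+Span b c) (∑∈ (λ q I → d q * T q I) term∈))

    isBasis : IsBasis I_T b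
    isBasis = record { members = b∈I_T ; independent = b-independent ; spanning = b-spans }

-- Scalars stay abstract here so that Cauchy sequences never unfold during the argument.
basis-and-dimension : (R : CommutativeRing 0ℓ 0ℓ) → NaturalMultiples.PositivesInvertible R →
  (α : List ℕ) → IsFenceShape α →
    let open FunctionSpace R
        open FenceFunctions R α
    in IsBasis I_T (lookup 𝓑) ×
       HasDimension I_T (sum (map (λ αᵢ → αᵢ ∸ 1) α))
basis-and-dimension R inv α shape =
  isBasis ,
  -- The same basis serves for the dimension; only its length is rewritten as the sum.
  subst (HasDimension I_T) (length-concat-tabulate (_∸ 1) α basisElement) (lookup 𝓑 , isBasis)
  where
  open FunctionSpace R
  open FenceFunctions R α
  open Enumeration (Fence.β α)
  open FenceBasis.Family R inv α shape (lookup 𝓑) (code basisElement) (lookup-list basisElement)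
    (code-injective basisElement) (code-surjective basisElement)

theorem4p4 : (α : List ℕ) → IsFenceShape α →
    let open FunctionSpace ℝ-commutativeRing
        open FenceFunctions ℝ-commutativeRing α
    in IsBasis I_T (lookup 𝓑) ×
       HasDimension I_T (sum (map (λ αᵢ → αᵢ ∸ 1) α))
theorem4p4 = basis-and-dimension ℝ-commutativeRing ℝ-positivesInvertible
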